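{- The following hold. (i) The number $n=1$ is $(\mathbb{Q}(\sqrt{3}),2\pi/3)$-congruent but not properly $(\mathbb{Q}(\sqrt{3}),2\pi/3)$-congruent. (ii) The number $n=3$ is properly $(\mathbb{Q}(\sqrt{13}),\pi/3)$-congruent, with a $(\mathbb{Q}(\sqrt{13}),\pi/3)$-triangle given as $\left(\frac{\sqrt{13}}{2},\frac{24\sqrt{13}}{13},\frac{43\sqrt{13}}{26}\right)$. (iii) The number $n=2$ is properly $(\mathbb{Q}(\sqrt{7}),2\pi/3)$-congruent, with a $(\mathbb{Q}(\sqrt{7}),2\pi/3)$-triangle given as $\left(\frac{3\sqrt{7}}{7},\frac{8\sqrt{7}}{3},\frac{61\sqrt{7}}{21}\right)$. (iv) The number $n=6$ is properly $(\mathbb{Q}(\sqrt{5}),\pi/3)$-congruent, with a $(\mathbb{Q}(\sqrt{5}),\pi/3)$-triangle given as $\left(\sqrt{5},\frac{12\sqrt{5}}{5},\frac{13\sqrt{5}}{5}\right)$.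
   Context: Let $\theta\in(0,\pi)$ with $\cos\theta=s/r\in\mathbb{Q}$, where $r,s$ are coprime integers and $r>0$; for $\theta=\pi/3$ one has $r=2,s=1$, and for $\theta=2\pi/3$ one has $r=2,s=-1$. Let $K$ be a real number field. A $(K,\theta)$-triangle for a positive integer $n$ is a triangle $(u,v,w)$ with side lengths $u,v,w\in K$ whose angle between the sides $u$ and $v$ is $\theta$ and whose area is $n\sqrt{r^2-s^2}$. The number $n$ is $(K,\theta)$-congruent if such a triangle exists, and properly $(K,\theta)$-congruent if there are infinitely many such triangles; the latter is equivalent to the group $E_{n,\theta}(K)$ having positive rank, where $E_{n,\theta}$ is the elliptic curve $y^2=x(x+(r+s)n)(x-(r-s)n)$.
   Formalization: In (iv) the given triangle has u²+v²=w², so its angle is π/2, not π/3; the formal text proves that 6 is properly (Q(√5),π/3)-congruent, and that it is properly (Q(√5),π/2)-congruent with the given triangle as a (Q(√5),π/2)-triangle. -}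

module Defs where

open import Data.Nat.Base as ℕ using (ℕ; NonZero)
open import Data.Nat.Coprimality using (Coprime; coprime?)
open import Data.Integer.Base as ℤ using (ℤ; +_; -[1+_])
open import Data.Rational.Base as ℚ using (ℚ; 0ℚ)
open import Data.Product.Base using (_×_; _,_; ∃-syntax; Σ-syntax)
open import Data.Sum.Base using (_⊎_)
open import Function.Bundles using (_↣_; Injection)
open import Relation.Binary.PropositionalEquality.Core using (_≡_)
open import Relation.Nullary.Decidable using (from-yes)

-- The real quadratic field ℚ(√d), meant for d > 0 not a square: ⟨ a , b ⟩
-- stands for a + b√d.  As √d is irrational the coordinates are
-- unique, and ℚ is kept in lowest terms, so _≡_ is equality in the field.

record ℚ[√_] (d : ℕ) : Set where
  constructor ⟨_,_⟩
  field
    rat : ℚ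
    irr : ℚ

fromℕ : ℕ → ℚ
fromℕ n = + n ℚ./ 1

module _ {d : ℕ} where

  infixl 6 _+_ _-_
  infixl 7 _*_
  infix  4 _<_
  infix  8 _√

  fromℚ : ℚ → ℚ[√ d ]
  fromℚ a = ⟨ a , 0ℚ ⟩

  -- q √ is q√d, where d is determined by the type.
  _√ : ℚ → ℚ[√ d ]
  q √ = ⟨ 0ℚ , q ⟩

  _+_ _-_ _*_ : ℚ[√ d ] → ℚ[√ d ] → ℚ[√ d ]
  ⟨ a , b ⟩ + ⟨ a′ , b′ ⟩ = ⟨ a ℚ.+ a′ , b ℚ.+ b′ ⟩
  ⟨ a , b ⟩ - ⟨ a′ , b′ ⟩ = ⟨ a ℚ.- a′ , b ℚ.- b′ ⟩
  ⟨ a , b ⟩ * ⟨ a′ , b′ ⟩ =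
    ⟨ a ℚ.* a′ ℚ.+ fromℕ d ℚ.* (b ℚ.* b′) , a ℚ.* b′ ℚ.+ b ℚ.* a′ ⟩

  -- The order inherited from ℝ through the embedding with √d > 0:
  -- a + b√d is positive iff  a > |b|√d  or  b√d > |a|.
  Positive : ℚ[√ d ] → Set
  Positive ⟨ a , b ⟩ =
      (0ℚ ℚ.< a × fromℕ d ℚ.* (b ℚ.* b) ℚ.< a ℚ.* a)
    ⊎ (0ℚ ℚ.< b × a ℚ.* a ℚ.< fromℕ d ℚ.* (b ℚ.* b))

  _<_ : ℚ[√ d ] → ℚ[√ d ] → Set
  x < y = Positive (y - x)

-- cos maps (0,π) bijectively onto (-1,1), so θ is recorded by its cosine: the
-- reduced fraction s/r, with |s| < r.

record Angle : Set where
  field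
    r          : ℕ
    s          : ℤ
    .{{r≢0}}   : NonZero r
    .coprime   : Coprime r ℤ.∣ s ∣
    .∣s∣<r     : ℤ.∣ s ∣ ℕ.< r

  cosine : ℚ
  cosine = s ℚ./ r

  -- r² - s², which is r² sin² θ
  r²-s² : ℚ
  r²-s² = (+ r ℤ.* + r ℤ.- s ℤ.* s) ℚ./ 1

π/3 : Angle
π/3 = record
  { r = 2 ; s = + 1
  ; coprime = from-yes (coprime? 2 1) ; ∣s∣<r = ℕ.s≤s (ℕ.s≤s ℕ.z≤n) }

π/2 : Angle
π/2 = record
  { r = 1 ; s = + 0
  ; coprime = from-yes (coprime? 1 0) ; ∣s∣<r = ℕ.s≤s ℕ.z≤n }

2π/3 : Angle
2π/3 = record
  { r = 2 ; s = -[1+ 0 ]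
  ; coprime = from-yes (coprime? 2 1) ; ∣s∣<r = ℕ.s≤s (ℕ.s≤s ℕ.z≤n) }

module _ {d : ℕ} where

  record IsTriangle (u v w : ℚ[√ d ]) : Set where
    field
      0<u   : fromℚ 0ℚ < u
      0<v   : fromℚ 0ℚ < v
      0<w   : fromℚ 0ℚ < w
      u<v+w : u < v + w
      v<u+w : v < u + w
      w<u+v : w < u + v

  -- θ is the angle between the sides u and v, by the law of cosines
  -- w² = u² + v² - 2uv cos θ.
  AngleBetween : (u v w : ℚ[√ d ]) → Angle → Set
  AngleBetween u v w θ =
    w * w ≡ u * u + v * v - fromℚ (fromℕ 2 ℚ.* Angle.cosine θ) * (u * v)

  -- Heron's formula; the area itself need not lie in ℚ(√d), its square does.
  16Area² : (u v w : ℚ[√ d ]) → ℚ[√ d ]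
  16Area² u v w = (u + v + w) * (v + w - u) * (u + w - v) * (u + v - w)

  -- The area is n√(r²-s²).  Area and n√(r²-s²) are both nonnegative, so the
  -- equation is expressed by its square.
  AreaIs : (u v w : ℚ[√ d ]) → Angle → ℕ → Set
  AreaIs u v w θ n =
    16Area² u v w
      ≡ fromℚ (fromℕ 16 ℚ.* (fromℕ n ℚ.* fromℕ n ℚ.* Angle.r²-s² θ))

-- (u , v , w) is a (ℚ(√d),θ)-triangle for n.
record IsTriangleFor (d : ℕ) (θ : Angle) (n : ℕ) (u v w : ℚ[√ d ]) : Set where
  field
    isTriangle : IsTriangle u v w
    angle      : AngleBetween u v w θ
    area       : AreaIs u v w θ n

Congruent : (d : ℕ) → Angle → (n : ℕ) → Set
Congruent d θ n = ∃[ u ] ∃[ v ] ∃[ w ] IsTriangleFor d θ n u v w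

-- Infinitely many triangles: an injective sequence of side triples.
ProperlyCongruent : (d : ℕ) → Angle → (n : ℕ) → Set
ProperlyCongruent d θ n =
  Σ[ f ∈ (ℕ ↣ (ℚ[√ d ] × ℚ[√ d ] × ℚ[√ d ])) ]
    (∀ i → let (u , v , w) = Injection.to f i in IsTriangleFor d θ n u v w)

{-# OPTIONS --safe #-}

-- A triangle (u , v , w) for n gives the point with x = (w / 2)² on the curve
-- y² = x (x + (r + s) n) (x - (r - s) n); moreover x + (r + s) n and
-- x - (r - s) n are the squares of (u + v) / 2 and (u - v) / 2.  Doubling that
-- point puts one more factor 2 into the denominator of w, so a single triangle
-- (u / z , v / z , w / z) with u, w odd and v even starts an infinite family;
-- its sides may moreover be multiplied by √d.
--
-- For n = 1 over ℚ(√3), the sum of the point and its conjugate is a rational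
-- point unless w² is rational, and if w² is rational then doubling the point
-- gives a rational point on the curve or on its twist by 3 unless u = v.  In
-- either case the point obtained provides a nonzero t with a² + t² = b² and
-- a² - 3t² = c², or with a² + 3t² = b² and a² - 9t² = c².  Both systems are
-- excluded by infinite descent on t, so u = v = 2 and w = 2√3.

module Submission where

-- For n = 1 the sides are kept unhalved: the area forces uv = 4, so w², (u + v)² and (u - v)² are
-- the three factors of x (x + 4) (x - 12) at x = w². A descent over ℚ(√3) itself would require its
-- arithmetic; conjugation and doubling lead back to rational points on the curve or on its twist.
-- At a sum of two such points, or at the double of any point, all three factors are squares. Over a
-- common denominator this reads a² + 4d² = b² and a² - 12d² = c², and t = 2d gives the first
-- system; on the twist t² is replaced by 3t², which gives the second. Each descent parametrises two
-- factorisations that share an unknown and refines the resulting equality of two products, which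
-- returns a solution of the same system with t at most halved.
--
-- The triangle named in (iv) satisfies 5 + 144/5 = 169/5, so its angle is right. It is therefore
-- established for `π/2`, while n = 6 at `π/3` comes from the rational triangle (3, 8, 7).

module Descent where

  open import Data.Bool.Base using (Bool; true; false; _∧_; T)
  open import Data.Empty using (⊥-elim)
  open import Data.Fin.Base using (Fin; zero; suc)
  open import Data.List.Base using (List; []; _∷_)
  open import Data.List.Relation.Unary.All using (All; []; _∷_)
  open import Data.Nat.Base
  open import Data.Nat.Coprimality as Coprimality using (Coprime; coprime-divisor; coprime-factors; coprime-/gcd)
  open import Data.Nat.Divisibility
  open import Data.Nat.DivMod
  open import Data.Nat.GCD using (gcd; gcd[m,n]∣m; gcd[m,n]∣n; gcd[m,n]≢0)
  open import Data.Nat.Induction using (<-wellFounded)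
  open import Data.Nat.Primality using (Prime; prime?; prime[2]; euclidsLemma; prime⇒irreducible)
  open import Data.Nat.Properties
  open import Data.Nat.Tactic.RingSolver using (solve-∀)
  open import Data.Product.Base using (_×_; _,_; ∃; ∃₂; proj₁; proj₂)
  open import Data.Sum.Base using (_⊎_; inj₁; inj₂; [_,_]′)
  open import Data.Vec.Base as Vec using (Vec; []; _∷_)
  open import Data.Vec.Properties using (lookup-map)
  open import Function.Base using (_∘_; case_of_)
  open import Induction.WellFounded using (Acc; acc)
  open import Relation.Binary.PropositionalEquality
  open import Relation.Nullary using (¬_; yes; no; contradiction)
  open import Relation.Nullary.Decidable using (from-yes)
  open import Algebra.Properties.CommutativeSemigroup *-commutativeSemigroup using (x∙yz≈y∙xz)

  -- Congruence obstructions checked by computation.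

  infixl 7 _⊕_
  infixl 8 _⊗_
  infix 9 _²
  infix 6 _≈_

  -- Equations over ℕ are reified so that they can be evaluated at residues. Terms stay free of
  -- subtraction, negative terms being moved to the other side.
  data Poly (n : ℕ) : Set where
    con     : ℕ → Poly n
    var     : Fin n → Poly n
    _⊕_ _⊗_ : Poly n → Poly n → Poly n

  record Equation (n : ℕ) : Set where
    constructor _≈_
    field
      lhs rhs : Poly n

  module _ {n : ℕ} where

    eval : Poly n → Vec ℕ n → ℕ
    eval (con c) ρ = c
    eval (var i) ρ = Vec.lookup ρ i
    eval (p ⊕ q) ρ = eval p ρ + eval q ρ
    eval (p ⊗ q) ρ = eval p ρ * eval q ρ

    _Solves_ : Vec ℕ n → Equation n → Set
    ρ Solves (p ≈ q) = eval p ρ ≡ eval q ρ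

  module Modulo (m : ℕ) .{{_ : NonZero m}} where

    eval-% : ∀ {n} (p : Poly n) ρ → eval p ρ % m ≡ eval p (Vec.map (_% m) ρ) % m
    eval-% (con c) ρ = refl
    eval-% (var i) ρ = trans (sym (m%n%n≡m%n (Vec.lookup ρ i) m)) (cong (_% m) (sym (lookup-map i (_% m) ρ)))
    eval-% (p ⊕ q) ρ = begin
      (eval p ρ + eval q ρ) % m                      ≡⟨ %-distribˡ-+ (eval p ρ) (eval q ρ) m ⟩
      (eval p ρ % m + eval q ρ % m) % m              ≡⟨ cong₂ (λ x y → (x + y) % m) (eval-% p ρ) (eval-% q ρ) ⟩
      (eval p ρ′ % m + eval q ρ′ % m) % m            ≡⟨ %-distribˡ-+ (eval p ρ′) (eval q ρ′) m ⟨
      (eval p ρ′ + eval q ρ′) % m                    ∎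
      where open ≡-Reasoning
            ρ′ = Vec.map (_% m) ρ
    eval-% (p ⊗ q) ρ = begin
      (eval p ρ * eval q ρ) % m                      ≡⟨ %-distribˡ-* (eval p ρ) (eval q ρ) m ⟩
      ((eval p ρ % m) * (eval q ρ % m)) % m          ≡⟨ cong₂ (λ x y → (x * y) % m) (eval-% p ρ) (eval-% q ρ) ⟩
      ((eval p ρ′ % m) * (eval q ρ′ % m)) % m        ≡⟨ %-distribˡ-* (eval p ρ′) (eval q ρ′) m ⟨
      (eval p ρ′ * eval q ρ′) % m                    ∎
      where open ≡-Reasoning
            ρ′ = Vec.map (_% m) ρ

    refutes : ∀ {n} → List (Equation n) → Vec ℕ n → Bool
    refutes []             ρ = false
    refutes ((p ≈ q) ∷ es) ρ with eval p ρ % m ≡ᵇ eval q ρ % m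
    ... | true  = refutes es ρ
    ... | false = true

    below : ℕ → (ℕ → Bool) → Bool
    below zero    P = true
    below (suc k) P = P k ∧ below k P

    everywhere : ∀ {n} → (Vec ℕ n → Bool) → Bool
    everywhere {zero}  P = P []
    everywhere {suc n} P = below m λ i → everywhere (P ∘ (i ∷_))

    ∧-proj : ∀ {x y} → T (x ∧ y) → T x × T y
    ∧-proj {true} t = _ , t

    below-sound : ∀ k P → T (below k P) → ∀ {i} → i < k → T (P i)
    below-sound (suc k) P t {i} i<1+k with m≤n⇒m<n∨m≡n (≤-pred i<1+k)
    ... | inj₁ i<k  = below-sound k P (proj₂ (∧-proj {P k} t)) i<k
    ... | inj₂ refl = proj₁ (∧-proj {P k} t)

    everywhere-sound : ∀ {n} (P : Vec ℕ n → Bool) → T (everywhere P) → ∀ ρ → T (P (Vec.map (_% m) ρ))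
    everywhere-sound P t []      = t
    everywhere-sound P t (x ∷ ρ) =
      everywhere-sound (P ∘ ((x % m) ∷_)) (below-sound m _ t (m%n<n x m)) ρ

    refutes-sound : ∀ {n} (es : List (Equation n)) ρ → T (refutes es (Vec.map (_% m) ρ)) → ¬ All (ρ Solves_) es
    refutes-sound ((p ≈ q) ∷ es) ρ t (e ∷ all)
      with eval p (Vec.map (_% m) ρ) % m ≡ᵇ eval q (Vec.map (_% m) ρ) % m in eq
    ... | true  = refutes-sound es ρ t all
    ... | false = subst T eq (≡⇒≡ᵇ _ _ (trans (sym (eval-% p ρ)) (trans (cong (_% m) e) (eval-% q ρ))))

    -- The implicit argument is computed by running through all residues.
    unsolvable : ∀ {n} (es : List (Equation n)) {_ : T (everywhere (refutes es))} ρ → ¬ All (ρ Solves_) es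
    unsolvable es {t} ρ = refutes-sound es ρ (everywhere-sound (refutes es) t ρ)

  open Modulo using (unsolvable)

  _² : ∀ {n} → Poly n → Poly n
  p ² = p ⊗ p

  x₀ : ∀ {n} → Poly (1 + n)
  x₀ = var zero
  x₁ : ∀ {n} → Poly (2 + n)
  x₁ = var (suc zero)
  x₂ : ∀ {n} → Poly (3 + n)
  x₂ = var (suc (suc zero))
  x₃ : ∀ {n} → Poly (4 + n)
  x₃ = var (suc (suc (suc zero)))

  -- Parity, coprimality and factorisations.

  data Odd : ℕ → Set where
    odd : ∀ k → Odd (1 + 2 * k)

  data ParityView : ℕ → Set where
    even : ∀ k → ParityView (2 * k)
    odd  : ∀ k → ParityView (1 + 2 * k)

  parityView : ∀ n → ParityView n
  parityView zero = even 0
  parityView (suc n) with parityView n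
  ... | even k = odd k
  ... | odd k  = subst ParityView (eq k) (even (1 + k))
    where
    eq : ∀ k → 2 * (1 + k) ≡ 1 + (1 + 2 * k)
    eq = solve-∀

  prime[3] : Prime 3
  prime[3] = from-yes (prime? 3)

  prime∣x² : ∀ {p} → Prime p → ∀ x → p ∣ x * x → p ∣ x
  prime∣x² pr x p∣ = [ (λ h → h) , (λ h → h) ]′ (euclidsLemma x x pr p∣)

  ∣-coprime : ∀ {k m n} → k ∣ m → Coprime m n → Coprime k n
  ∣-coprime k∣m c (i∣k , i∣n) = c (∣-trans i∣k k∣m , i∣n)

  coprime-* : ∀ {m n o} → Coprime m n → Coprime m o → Coprime m (n * o)
  coprime-* mn mo (i∣m , i∣no) = mo (i∣m , coprime-divisor (∣-coprime i∣m mn) i∣no)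

  coprime-sq : ∀ {m n} → Coprime m n → Coprime m (n * n)
  coprime-sq c = coprime-* c c

  coprime-sqs : ∀ {m n} → Coprime m n → Coprime (m * m) (n * n)
  coprime-sqs c = Coprimality.sym (coprime-sq (Coprimality.sym (coprime-sq c)))

  prime∤⇒coprime : ∀ {p n} → Prime p → ¬ p ∣ n → Coprime p n
  prime∤⇒coprime pr p∤n (i∣p , i∣n) with prime⇒irreducible pr i∣p
  ... | inj₁ i≡1  = i≡1
  ... | inj₂ refl = contradiction i∣n p∤n

  -- Euler's four-number lemma: a two by two table with rows α, β and γ, δ whose row products are
  -- `a`, `b` and whose column products are `c`, `d`.
  record Refinement (a b c d : ℕ) : Set where
    constructor refinement
    field
      α β γ δ : ℕ
      a≡αβ : a ≡ α * β
      b≡γδ : b ≡ γ * δ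
      c≡αγ : c ≡ α * γ
      d≡βδ : d ≡ β * δ
      coprime : Coprime β γ

  -- With α = gcd(a, c) the cofactors β and γ are coprime and βb = γd, so β divides `d`. That `a` is
  -- nonzero makes `g` and `β` cancellable.
  refine : ∀ a b c d .{{_ : NonZero a}} → a * b ≡ c * d → Refinement a b c d
  refine a b c d ab≡cd = refinement g β γ δ a≡gβ b≡γδ c≡gγ d≡βδ βγ
    where
    open ≡-Reasoning
    g = gcd a c
    instance
      g≢0 : NonZero g
      g≢0 = ≢-nonZero (gcd[m,n]≢0 a c (inj₁ (≢-nonZero⁻¹ a)))
    β = a / g
    γ = c / g
    a≡gβ : a ≡ g * β
    a≡gβ = sym (m*[n/m]≡n (gcd[m,n]∣m a c))
    c≡gγ : c ≡ g * γ
    c≡gγ = sym (m*[n/m]≡n (gcd[m,n]∣n a c))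
    βγ : Coprime β γ
    βγ = coprime-/gcd a c
    instance
      β≢0 : NonZero β
      β≢0 = ≢-nonZero λ β≡0 → ≢-nonZero⁻¹ a (trans a≡gβ (trans (cong (g *_) β≡0) (*-zeroʳ g)))
    βb≡γd : β * b ≡ γ * d
    βb≡γd = *-cancelˡ-≡ _ _ g (begin
      g * (β * b) ≡⟨ *-assoc g β b ⟨
      g * β * b   ≡⟨ cong (_* b) a≡gβ ⟨
      a * b       ≡⟨ ab≡cd ⟩
      c * d       ≡⟨ cong (_* d) c≡gγ ⟩
      g * γ * d   ≡⟨ *-assoc g γ d ⟩
      g * (γ * d) ∎)
    β∣d : β ∣ d
    β∣d = coprime-divisor βγ (subst (β ∣_) βb≡γd (m∣m*n b))
    δ = quotient β∣d
    d≡βδ : d ≡ β * δ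
    d≡βδ = m∣n⇒n≡m*quotient β∣d
    b≡γδ : b ≡ γ * δ
    b≡γδ = *-cancelˡ-≡ _ _ β (begin
      β * b       ≡⟨ βb≡γd ⟩
      γ * d       ≡⟨ cong (γ *_) d≡βδ ⟩
      γ * (β * δ) ≡⟨ x∙yz≈y∙xz γ β δ ⟩
      β * (γ * δ) ∎)

  -- Refining xy = zz gives αγ = βδ. Since α divides `x` and δ divides `y`, they are coprime, and so
  -- are β and γ; hence α and β divide each other, and then γ = δ.
  coprime-factors-of-square : ∀ x y z .{{_ : NonZero x}} → Coprime x y → x * y ≡ z * z →
    ∃₂ λ p q → x ≡ p * p × y ≡ q * q × z ≡ p * q
  coprime-factors-of-square x y z x⊥y xy≡zz = go (refine x y z z xy≡zz) x⊥y
    where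
    go : ∀ {x y} .{{_ : NonZero x}} → Refinement x y z z → Coprime x y → ∃₂ λ p q → x ≡ p * p × y ≡ q * q × z ≡ p * q
    go (refinement α β γ δ refl refl z≡αγ z≡βδ βγ) xy = α , γ , cong (α *_) (sym α≡β) , cong (γ *_) (sym γ≡δ) , z≡αγ
      where
      α∣β : α ∣ β
      α∣β = coprime-divisor {n = δ} (∣-coprime (m∣m*n β) (Coprimality.sym (∣-coprime (n∣m*n γ) (Coprimality.sym xy))))
              (subst (α ∣_) (trans (sym z≡αγ) (trans z≡βδ (*-comm β δ))) (m∣m*n γ))
      β∣α : β ∣ α
      β∣α = coprime-divisor βγ (subst (β ∣_) (trans (sym z≡βδ) (trans z≡αγ (*-comm α γ))) (m∣m*n δ))
      α≡β : α ≡ β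
      α≡β = ∣-antisym α∣β β∣α
      instance
        α≢0 : NonZero α
        α≢0 = m*n≢0⇒m≢0 α
      γ≡δ : γ ≡ δ
      γ≡δ = *-cancelˡ-≡ _ _ α (trans (sym z≡αγ) (trans z≡βδ (cong (_* δ) (sym α≡β))))


  -- Descent for a² + t² = b² and a² - 3t² = c².

  ≤⇒∃+ : ∀ {m n} → m ≤ n → ∃ λ x → n ≡ m + x
  ≤⇒∃+ m≤n = _ , sym (m+[n∸m]≡n m≤n)

  coprime-product : ∀ k b c n → Coprime b c → k ∣ b * n → k ∣ c * n → k ∣ n
  coprime-product k b c n bc k∣bn k∣cn = coprime-factors bc (k∣bn , k∣cn)

  ∣3⇒1∨3 : ∀ {k} → k ∣ 3 → k ≡ 1 ⊎ k ≡ 3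
  ∣3⇒1∨3 = prime⇒irreducible prime[3]

  -- Stands in for subtracting `z` from both sides; the two outer equations are identities left to
  -- the ring solver.
  cancel : ∀ {l l′ r r′} z → l′ + z ≡ l → l ≡ r → r ≡ r′ + z → l′ ≡ r′
  cancel z e f g = +-cancelʳ-≡ z _ _ (trans e (trans f g))

  -- α²(β² - γ²) = δ²(β² - 4γ²) with coprime α, δ forces β² - γ² = kδ² and
  -- β² - 4γ² = kα², where k divides 3.
  data Split₁ (a b c d : ℕ) : Set where
    case₊₁ : b ≡ c + d → d ≡ 3 * c + a → Split₁ a b c d
    case₊₃ : b ≡ c + 3 * d → d ≡ c + a → Split₁ a b c d
    case₋₁ : c ≡ b + d → a ≡ 3 * b + 4 * d → Split₁ a b c d
    case₋₃ : c ≡ b + 3 * d → a ≡ b + 4 * d → Split₁ a b c d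

  split₁ : ∀ a b c d .{{_ : NonZero d}} → Coprime a d → Coprime b c →
    a * b + 4 * (c * d) ≡ a * c + b * d → Split₁ a b c d
  split₁ a b c d ad bc h with ≤-total c b
  ... | inj₁ c≤b with ≤⇒∃+ c≤b
  ...   | x , refl = conclude (∣3⇒1∨3 k∣3)
    where
    h₁ : a * x + 3 * (c * d) ≡ x * d
    h₁ = cancel (a * c + c * d) (e a x c d) h (f a x c d)
      where
      e : ∀ a x c d → a * x + 3 * (c * d) + (a * c + c * d) ≡ a * (c + x) + 4 * (c * d)
      e = solve-∀
      f : ∀ a x c d → a * c + (c + x) * d ≡ x * d + (a * c + c * d)
      f = solve-∀
    d∣x : d ∣ x
    d∣x = coprime-divisor (Coprimality.sym ad)
      (∣m+n∣m⇒∣n (subst (d ∣_) (trans (sym h₁) (+-comm (a * x) _)) (n∣m*n x)) (∣n⇒∣m*n 3 (n∣m*n c)))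
    k = quotient d∣x
    x≡kd : x ≡ k * d
    x≡kd = m∣n⇒n≡quotient*m d∣x
    h₂ : a * k + 3 * c ≡ k * d
    h₂ = *-cancelʳ-≡ _ _ d (trans (e a k c d) (subst (λ x → a * x + 3 * (c * d) ≡ x * d) x≡kd h₁))
      where
      e : ∀ a k c d → (a * k + 3 * c) * d ≡ a * (k * d) + 3 * (c * d)
      e = solve-∀
    k∣3c : k ∣ c * 3
    k∣3c = subst (k ∣_) (*-comm 3 c) (∣m+n∣m⇒∣n (subst (k ∣_) (sym h₂) (m∣m*n d)) (n∣m*n a))
    -- `k` divides 3c and x, hence also 3(c + x), and `c` is coprime to c + x.
    k∣3 : k ∣ 3
    k∣3 = coprime-product k (c + x) c 3 bc
      (subst (k ∣_) (sym (*-distribʳ-+ 3 c x)) (∣m∣n⇒∣m+n k∣3c (∣m⇒∣m*n 3 (subst (k ∣_) (sym x≡kd) (m∣m*n d))))) k∣3c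
    conclude : k ≡ 1 ⊎ k ≡ 3 → Split₁ a (c + x) c d
    conclude (inj₁ k≡1) = case₊₁ (cong (c +_) (trans x≡kd (trans (cong (_* d) k≡1) (*-identityˡ d))))
       (trans (sym (*-identityˡ d)) (trans (cong (_* d) (sym k≡1)) (trans (sym h₂) (trans (cong (λ k → a * k + 3 * c) k≡1) (e a c)))))
       where
       e : ∀ a c → a * 1 + 3 * c ≡ 3 * c + a
       e = solve-∀
    conclude (inj₂ k≡3) = case₊₃ (cong (c +_) (trans x≡kd (cong (_* d) k≡3)))
       (*-cancelˡ-≡ _ _ 3 (trans (cong (_* d) (sym k≡3)) (trans (sym h₂) (trans (cong (λ k → a * k + 3 * c) k≡3) (e a c)))))
       where
       e : ∀ a c → a * 3 + 3 * c ≡ 3 * (c + a)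
       e = solve-∀
  split₁ a b c d ad bc h | inj₂ b≤c with ≤⇒∃+ b≤c
  ...   | x , refl = conclude (∣3⇒1∨3 k∣3)
    where
    h₁ : 3 * (b * d) + 4 * (x * d) ≡ a * x
    h₁ = cancel (a * b + b * d) (e a x b d) h (f a x b d)
      where
      e : ∀ a x b d → 3 * (b * d) + 4 * (x * d) + (a * b + b * d) ≡ a * b + 4 * ((b + x) * d)
      e = solve-∀
      f : ∀ a x b d → a * (b + x) + b * d ≡ a * x + (a * b + b * d)
      f = solve-∀
    d∣x : d ∣ x
    d∣x = coprime-divisor (Coprimality.sym ad)
      (subst (d ∣_) h₁ (∣m∣n⇒∣m+n (∣n⇒∣m*n 3 (n∣m*n b)) (∣n⇒∣m*n 4 (n∣m*n x))))
    k = quotient d∣x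
    x≡kd : x ≡ k * d
    x≡kd = m∣n⇒n≡quotient*m d∣x
    h₂ : b * 3 + k * (4 * d) ≡ k * a
    h₂ = *-cancelʳ-≡ _ _ d (trans (e b k d) (trans (subst (λ x → 3 * (b * d) + 4 * (x * d) ≡ a * x) x≡kd h₁) (f a k d)))
      where
      e : ∀ b k d → (b * 3 + k * (4 * d)) * d ≡ 3 * (b * d) + 4 * (k * d * d)
      e = solve-∀
      f : ∀ a k d → a * (k * d) ≡ k * a * d
      f = solve-∀
    k∣3b : k ∣ b * 3
    k∣3b = ∣m+n∣m⇒∣n (subst (k ∣_) (trans (sym h₂) (+-comm (b * 3) _)) (m∣m*n a)) (m∣m*n (4 * d))
    k∣3 : k ∣ 3
    k∣3 = coprime-product k b (b + x) 3 bc k∣3b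
      (subst (k ∣_) (sym (*-distribʳ-+ 3 b x)) (∣m∣n⇒∣m+n k∣3b (∣m⇒∣m*n 3 (subst (k ∣_) (sym x≡kd) (m∣m*n d)))))
    conclude : k ≡ 1 ⊎ k ≡ 3 → Split₁ a b (b + x) d
    conclude (inj₁ k≡1) = case₋₁ (cong (b +_) (trans x≡kd (trans (cong (_* d) k≡1) (*-identityˡ d))))
       (trans (sym (*-identityˡ a)) (trans (sym (subst (λ k → b * 3 + k * (4 * d) ≡ k * a) k≡1 h₂)) (e b d)))
       where
       e : ∀ b d → b * 3 + 1 * (4 * d) ≡ 3 * b + 4 * d
       e = solve-∀
    conclude (inj₂ k≡3) = case₋₃ (cong (b +_) (trans x≡kd (cong (_* d) k≡3)))
       (*-cancelˡ-≡ _ _ 3 (trans (sym (subst (λ k → b * 3 + k * (4 * d) ≡ k * a) k≡3 h₂)) (e b d)))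
       where
       e : ∀ b d → b * 3 + 3 * (4 * d) ≡ 3 * (b + 4 * d)
       e = solve-∀

  record Quadruple₁ (t : ℕ) : Set where
    constructor quadruple
    field
      a b c   : ℕ
      coprime : Coprime a t
      a²+t²   : a * a + t * t ≡ b * b
      a²-3t²  : a * a ≡ 3 * (t * t) + c * c

  ¬2∣⇒odd : ∀ {n} → ¬ 2 ∣ n → Odd n
  ¬2∣⇒odd {n} ¬2∣n with parityView n
  ... | even k = contradiction (m∣m*n k) ¬2∣n
  ... | odd k  = odd k

  coprime-even⇒odd : ∀ {m} k → Coprime m (2 * k) → Odd m
  coprime-even⇒odd k c = ¬2∣⇒odd λ 2∣m → case (c (2∣m , m∣m*n k)) of λ ()

  odd-factorˡ : ∀ {m n} → Odd (m * n) → Odd m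
  odd-factorˡ {m} {n} o = ¬2∣⇒odd λ 2∣m → ¬2∣odd o (∣m⇒∣m*n n 2∣m)
    where
    ¬2∣odd : ∀ {n} → Odd n → ¬ 2 ∣ n
    ¬2∣odd (odd k) 2∣ = contradiction (∣m+n∣m⇒∣n (subst (2 ∣_) (+-comm 1 (2 * k)) 2∣) (m∣m*n k)) λ 2∣1 → case (∣1⇒≡1 2∣1) of λ ()

  odd-factorʳ : ∀ {m n} → Odd (m * n) → Odd n
  odd-factorʳ {m} {n} o = odd-factorˡ (subst Odd (*-comm m n) o)

  -- The obstruction to k = 3: modulo 4 it would say 1 = 3.
  β²≢4γ²+3α² : ∀ {α β} γ → Odd α → Odd β → ¬ β * β ≡ 4 * (γ * γ) + 3 * (α * α)
  β²≢4γ²+3α² γ (odd i) (odd j) e = unsolvable 4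
    ((con 1 ⊕ con 2 ⊗ x₁) ² ≈ con 4 ⊗ x₂ ² ⊕ con 3 ⊗ (con 1 ⊕ con 2 ⊗ x₀) ² ∷ []) (i ∷ j ∷ γ ∷ []) (e ∷ [])

  -- The obstruction to k = -1, again 1 = 3 modulo 4.
  α²≢3β²+4δ² : ∀ {α β} δ → Odd α → Odd β → ¬ α * α ≡ 3 * (β * β) + 4 * (δ * δ)
  α²≢3β²+4δ² δ (odd i) (odd j) e = unsolvable 4
    ((con 1 ⊕ con 2 ⊗ x₀) ² ≈ con 3 ⊗ (con 1 ⊕ con 2 ⊗ x₁) ² ⊕ con 4 ⊗ x₂ ² ∷ []) (i ∷ j ∷ δ ∷ []) (e ∷ [])

  -- The refinement of pq = mn turns the sums of squares into α²(β² - γ²) = δ²(β² - 4γ²). Here k = 1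
  -- and k = -3 return the original system with t = γ and t = δ, both divisors of `q`; k = 3 and k =
  -- -1 contradict that α and β are odd, as factors of the odd number `p`.
  descend₁ : ∀ p q m n .{{_ : NonZero p}} .{{_ : NonZero q}} → Coprime p (2 * q) → p * q ≡ m * n →
    p * p + 4 * (q * q) ≡ m * m + n * n → ∃ λ t → Quadruple₁ t × t ∣ q
  descend₁ p q m n p⊥2q pq≡mn sum = go (refine p q m n pq≡mn) p⊥2q sum
    where
    go : ∀ {p q m n} .{{_ : NonZero q}} → Refinement p q m n → Coprime p (2 * q) →
      p * p + 4 * (q * q) ≡ m * m + n * n → ∃ λ t → Quadruple₁ t × t ∣ q
    go (refinement α β γ δ refl refl refl refl βγ) p⊥2q sum =
      conclude (split₁ (α * α) (β * β) (γ * γ) (δ * δ) {{m*n≢0 δ δ}} (coprime-sqs αδ) (coprime-sqs βγ) eq)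
      where
      instance
        δ≢0 : NonZero δ
        δ≢0 = m*n≢0⇒n≢0 γ
      αδ : Coprime α δ
      αδ = ∣-coprime (m∣m*n β) (Coprimality.sym (∣-coprime (∣n⇒∣m*n 2 (n∣m*n γ)) (Coprimality.sym p⊥2q)))
      αβ-odd : Odd (α * β)
      αβ-odd = coprime-even⇒odd (γ * δ) p⊥2q
      α-odd : Odd α
      α-odd = odd-factorˡ αβ-odd
      β-odd : Odd β
      β-odd = odd-factorʳ {α} αβ-odd
      eq : α * α * (β * β) + 4 * (γ * γ * (δ * δ)) ≡ α * α * (γ * γ) + β * β * (δ * δ)
      eq = trans (e α β γ δ) (trans sum (f α β γ δ))
        where
        e : ∀ α β γ δ → α * α * (β * β) + 4 * (γ * γ * (δ * δ)) ≡ α * β * (α * β) + 4 * (γ * δ * (γ * δ))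
        e = solve-∀
        f : ∀ α β γ δ → α * γ * (α * γ) + β * δ * (β * δ) ≡ α * α * (γ * γ) + β * β * (δ * δ)
        f = solve-∀
      conclude : Split₁ (α * α) (β * β) (γ * γ) (δ * δ) → ∃ λ t → Quadruple₁ t × t ∣ γ * δ
      conclude (case₊₁ b≡c+d d≡3c+a) = γ , quadruple δ β α
        (λ {i} (i∣δ , i∣γ) → Coprimality.sym (coprime-sq (Coprimality.sym βγ)) (subst (i ∣_) (sym b≡c+d) (∣m∣n⇒∣m+n (∣m⇒∣m*n γ i∣γ) (∣m⇒∣m*n δ i∣δ)) , i∣γ))
        (trans (+-comm (δ * δ) _) (sym b≡c+d)) d≡3c+a , m∣m*n δ
      conclude (case₋₃ c≡b+3d a≡b+4d) = δ , quadruple γ α β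
        (λ {i} (i∣γ , i∣δ) → Coprimality.sym (coprime-sq (Coprimality.sym βγ)) (∣m+n∣m⇒∣n (subst (i ∣_) (trans c≡b+3d (+-comm (β * β) _)) (∣m⇒∣m*n γ i∣γ)) (∣n⇒∣m*n 3 (∣m⇒∣m*n δ i∣δ)) , i∣γ))
        (trans (cong (_+ δ * δ) c≡b+3d) (trans (e (β * β) (δ * δ)) (sym a≡b+4d)))
        (trans c≡b+3d (+-comm (β * β) _)) , n∣m*n γ
        where
        e : ∀ b d → b + 3 * d + d ≡ b + 4 * d
        e = solve-∀
      conclude (case₊₃ b≡c+3d d≡c+a) = ⊥-elim (β²≢4γ²+3α² γ α-odd β-odd (trans b≡c+3d (trans (cong (λ d → γ * γ + 3 * d) d≡c+a) (e (γ * γ) (α * α)))))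
        where
        e : ∀ c a → c + 3 * (c + a) ≡ 4 * c + 3 * a
        e = solve-∀
      conclude (case₋₁ c≡b+d a≡3b+4d) = ⊥-elim (α²≢3β²+4δ² δ α-odd β-odd a≡3b+4d)

  odd-difference : ∀ {m n} → Odd m → Odd n → n ≤ m → ∃ λ x → m ≡ n + 2 * x
  odd-difference (odd i) (odd j) n≤m with ≤⇒∃+ (*-cancelˡ-≤ {j} {i} 2 (≤-pred n≤m))
  ... | x , refl = x , e j x
    where
    e : ∀ j x → 1 + 2 * (j + x) ≡ 1 + 2 * j + 2 * x
    e = solve-∀

  square-cancel-≤ : ∀ {m n} → m * m ≤ n * n → m ≤ n
  square-cancel-≤ {m} {n} h with m ≤? n
  ... | yes m≤n = m≤n
  ... | no m≰n = contradiction h (<⇒≱ (*-mono-< (≰⇒> m≰n) (≰⇒> m≰n)))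

  record OddTriple (a t b : ℕ) : Set where
    constructor oddTriple
    field
      p q : ℕ
      a+q²≡p² : a + q * q ≡ p * p
      b≡p²+q² : b ≡ p * p + q * q
      t≡pq    : t ≡ p * q
      p⊥q     : Coprime p q

  -- Primitive Pythagorean triples with even leg 2t: for b = a + 2y the equation becomes (a + y) y =
  -- t² with coprime factors, so both are squares.
  oddPythagorean : ∀ {a t b} .{{_ : NonZero t}} → Odd a → Odd b → Coprime a t →
    a * a + 4 * (t * t) ≡ b * b → OddTriple a t b
  oddPythagorean {a} {t} {b} a-odd b-odd a⊥t a²+4t²≡b² with odd-difference b-odd a-odd
      (square-cancel-≤ (≤-trans (m≤m+n (a * a) _) (≤-reflexive a²+4t²≡b²)))
  ... | y , refl = conclude (coprime-factors-of-square (a + y) y t {{a+y≢0}} a+y⊥y xy≡t²)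
    where
    xy≡t² : (a + y) * y ≡ t * t
    xy≡t² = *-cancelˡ-≡ _ _ 4 (cancel (a * a) (e a y) (sym a²+4t²≡b²) (+-comm (a * a) _))
      where
      e : ∀ a y → 4 * ((a + y) * y) + a * a ≡ (a + 2 * y) * (a + 2 * y)
      e = solve-∀
    a+y≢0 : NonZero (a + y)
    a+y≢0 = m*n≢0⇒m≢0 (a + y) {{subst NonZero (sym xy≡t²) (m*n≢0 t t)}}
    a+y⊥y : Coprime (a + y) y
    a+y⊥y {i} (i∣a+y , i∣y) = coprime-sq a⊥t
      ( ∣m+n∣m⇒∣n (subst (i ∣_) (+-comm a y) i∣a+y) i∣y
      , subst (i ∣_) xy≡t² (∣n⇒∣m*n (a + y) i∣y))
    conclude : (∃₂ λ p q → a + y ≡ p * p × y ≡ q * q × t ≡ p * q) → OddTriple a t (a + 2 * y)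
    conclude (p , q , a+y≡p² , refl , t≡pq) = oddTriple p q a+y≡p²
      (trans (e a (q * q)) (cong (_+ q * q) a+y≡p²)) t≡pq
      λ {i} (i∣p , i∣q) → a+y⊥y (subst (i ∣_) (sym a+y≡p²) (∣m⇒∣m*n p i∣p) , ∣m⇒∣m*n q i∣q)
      where
      e : ∀ a y → a + 2 * y ≡ a + y + y
      e = solve-∀

  data Halved (p q s : ℕ) : Set where
    halvedˡ : ∀ h → p ≡ 2 * h → h * q ≡ s → Halved p q s
    halvedʳ : ∀ h → q ≡ 2 * h → p * h ≡ s → Halved p q s

  halve : ∀ p q s → 2 * s ≡ p * q → Halved p q s
  halve p q s 2s≡pq with euclidsLemma p q prime[2] (subst (2 ∣_) 2s≡pq (m∣m*n s))
  ... | inj₁ 2∣p = halvedˡ h p≡2h (*-cancelˡ-≡ _ _ 2 (trans (sym (*-assoc 2 h q)) (trans (cong (_* q) (sym p≡2h)) (sym 2s≡pq))))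
    where
    h = quotient 2∣p
    p≡2h = m∣n⇒n≡m*quotient 2∣p
  ... | inj₂ 2∣q = halvedʳ h q≡2h (*-cancelˡ-≡ _ _ 2 (trans (x∙yz≈y∙xz 2 p h) (trans (cong (p *_) (sym q≡2h)) (sym 2s≡pq))))
    where
    h = quotient 2∣q
    q≡2h = m∣n⇒n≡m*quotient 2∣q

  t∣s⇒t<2s : ∀ {t s} .{{_ : NonZero s}} → t ∣ s → t < 2 * s
  t∣s⇒t<2s {t} {s} t∣s = ≤-<-trans (∣⇒≤ t∣s) (m<m+n s {s + 0} (>-nonZero⁻¹ (s + 0) {{subst NonZero (sym (+-identityʳ s)) (≢-nonZero (≢-nonZero⁻¹ s))}}))

  ∣-nonZero : ∀ {m n} .{{_ : NonZero n}} → m ∣ n → NonZero m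
  ∣-nonZero {suc m} _ = _
  ∣-nonZero {zero} {n} 0∣n = contradiction (0∣⇒≡0 0∣n) (≢-nonZero⁻¹ n)

  -- For odd `t` the first equation forces a² = 0 modulo 8, and then the second gives c² = 5.
  even-t₁ : ∀ {a b c} t → a * a + t * t ≡ b * b → a * a ≡ 3 * (t * t) + c * c → ∃ λ s → t ≡ 2 * s
  even-t₁ {a} {b} {c} t eq₁ eq₂ with parityView t
  ... | even s = s , refl
  ... | odd k = ⊥-elim (unsolvable 8
     ( x₀ ² ⊕ (con 1 ⊕ con 2 ⊗ x₁) ² ≈ x₂ ² ∷ x₀ ² ≈ con 3 ⊗ (con 1 ⊕ con 2 ⊗ x₁) ² ⊕ x₃ ² ∷ []) (a ∷ k ∷ b ∷ c ∷ []) (eq₁ ∷ eq₂ ∷ []))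

  -- For t = 2s both b² = c² + 4t² and b² = a² + 4s² are primitive Pythagorean triples with
  -- hypotenuse `b`. Their parameters satisfy p² + q² = m² + n² and pq = 2mn, so p or q is even;
  -- halving it gives the situation of `descend₁`, and the new t divides s.
  step₁ : ∀ t .{{_ : NonZero t}} → Quadruple₁ t → ∃ λ t′ → Quadruple₁ t′ × NonZero t′ × t′ < t
  step₁ t (quadruple a b c a⊥t eq₁ eq₂) with even-t₁ {a} {b} {c} t eq₁ eq₂
  ... | s , refl = conclude (oddPythagorean {t = 2 * s} c-odd b-odd c⊥t (trans (+-comm (c * c) _) (sym b²≡4t²+c²))) (oddPythagorean a-odd b-odd a⊥s (trans (cong (a * a +_) (sq s)) eq₁))
    where
    Smaller = ∃ λ t′ → Quadruple₁ t′ × NonZero t′ × t′ < 2 * s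
    instance
      s≢0 : NonZero s
      s≢0 = m*n≢0⇒n≢0 2
    a-odd : Odd a
    a-odd = coprime-even⇒odd s a⊥t
    sq : ∀ s → 4 * (s * s) ≡ 2 * s * (2 * s)
    sq = solve-∀
    b-odd : Odd b
    b-odd = odd-b (parityView b) a-odd eq₁
      where
      odd-b : ∀ {a b} → ParityView b → Odd a → a * a + 2 * s * (2 * s) ≡ b * b → Odd b
      odd-b (odd j)  _       _ = odd j
      odd-b (even j) (odd i) e = ⊥-elim (unsolvable 4
        ((con 1 ⊕ con 2 ⊗ x₀) ² ⊕ (con 2 ⊗ x₁) ² ≈ (con 2 ⊗ x₂) ² ∷ []) (i ∷ s ∷ j ∷ []) (e ∷ []))
    c-odd : Odd c
    c-odd = odd-c (parityView c) a-odd eq₂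
      where
      odd-c : ∀ {a c} → ParityView c → Odd a → a * a ≡ 3 * (2 * s * (2 * s)) + c * c → Odd c
      odd-c (odd j)  _       _ = odd j
      odd-c (even j) (odd i) e = ⊥-elim (unsolvable 4
        ((con 1 ⊕ con 2 ⊗ x₀) ² ≈ con 3 ⊗ (con 2 ⊗ x₁) ² ⊕ (con 2 ⊗ x₂) ² ∷ []) (i ∷ s ∷ j ∷ []) (e ∷ []))
    b²≡4t²+c² : b * b ≡ 4 * (2 * s * (2 * s)) + c * c
    b²≡4t²+c² = trans (sym eq₁) (trans (cong (_+ 2 * s * (2 * s)) eq₂) (e (2 * s * (2 * s)) (c * c)))
      where
      e : ∀ t c → 3 * t + c + t ≡ 4 * t + c
      e = solve-∀
    c⊥t : Coprime c (2 * s)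
    c⊥t {i} (i∣c , i∣t) = Coprimality.sym (coprime-sq (Coprimality.sym a⊥t))
      (subst (i ∣_) (sym eq₂) (∣m∣n⇒∣m+n (∣n⇒∣m*n 3 (∣m⇒∣m*n (2 * s) i∣t)) (∣m⇒∣m*n c i∣c)) , i∣t)
    a⊥s : Coprime a s
    a⊥s = Coprimality.sym (∣-coprime (n∣m*n 2) (Coprimality.sym a⊥t))
    conclude : OddTriple c (2 * s) b → OddTriple a s b → Smaller
    conclude (oddTriple p q _ b≡p²+q² t≡pq p⊥q) (oddTriple m n _ b≡m²+n² s≡mn _) = from-half (halve p q s t≡pq)
      where
      instance
        pq≢0 : NonZero (p * q)
        pq≢0 = subst NonZero t≡pq (m*n≢0 2 s)
      p≢0 : NonZero p
      p≢0 = m*n≢0⇒m≢0 p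
      q≢0 : NonZero q
      q≢0 = m*n≢0⇒n≢0 p
      finish : ∀ p h → NonZero p → NonZero (2 * h) → Coprime p (2 * h) → p * h ≡ s → p * p + 2 * h * (2 * h) ≡ b → Smaller
      finish p h p≢0 2h≢0 p⊥2h ph≡s sum =
        let t′ , quad , t′∣h = descend₁ p h m n {{p≢0}} {{m*n≢0⇒n≢0 2 {{2h≢0}}}} p⊥2h (trans ph≡s s≡mn)
                                (trans (cong (p * p +_) (sq h)) (trans sum b≡m²+n²))
            t′∣s = subst (t′ ∣_) ph≡s (∣n⇒∣m*n p t′∣h)
        in t′ , quad , ∣-nonZero t′∣s , t∣s⇒t<2s t′∣s
      from-half : Halved p q s → Smaller
      from-half (halvedʳ h refl ph≡s) = finish p h p≢0 q≢0 p⊥q ph≡s (sym b≡p²+q²)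
      from-half (halvedˡ h refl hq≡s) = finish q h q≢0 p≢0 (Coprimality.sym p⊥q) (trans (*-comm q h) hq≡s) (trans (+-comm (q * q) _) (sym b≡p²+q²))

  no-quadruple₁ : ∀ t .{{_ : NonZero t}} → ¬ Quadruple₁ t
  no-quadruple₁ t = go t (<-wellFounded t)
    where
    go : ∀ t → Acc _<_ t → .{{_ : NonZero t}} → ¬ Quadruple₁ t
    go t (acc smaller) quad with step₁ t quad
    ... | t′ , quad′ , t′≢0 , t′<t = go t′ (smaller t′<t) {{t′≢0}} quad′

  -- Descent for a² + 3t² = b² and a² - 9t² = c².

  record Quadruple₂ (t : ℕ) : Set where
    constructor quadruple
    field
      a b c   : ℕ
      coprime : Coprime a t
      a²+3t²  : a * a + 3 * (t * t) ≡ b * b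
      a²-9t²  : a * a ≡ 9 * (t * t) + c * c

  -- The equation is b (12a + d) = c (9a + d). As 3a is coprime to `d`, so are 9a + d and 12a + d;
  -- two proportional pairs of coprime numbers coincide, whence b = 9a + d and c = 12a + d.
  split₂ : ∀ a b c d .{{_ : NonZero a}} .{{_ : NonZero b}} → Coprime (3 * a) d → Coprime b c →
    12 * (a * b) + b * d ≡ 9 * (a * c) + c * d → c ≡ b + 3 * a × b ≡ 9 * a + d
  split₂ a b c d 3a⊥d b⊥c h with ≤-total c b
  ... | inj₁ c≤b = contradiction (sym h) (<⇒≢ (+-mono-<-≤
          (≤-<-trans (*-monoʳ-≤ 9 (*-monoʳ-≤ a c≤b)) (*-monoˡ-< (a * b) {{m*n≢0 a b}} {9} {12} (s≤s (m≤m+n 9 2))))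
          (*-monoˡ-≤ d c≤b)))
  ... | inj₂ b≤c with ≤⇒∃+ b≤c
  ...   | x , refl = cong (b +_) x≡3a , trans (sym (*-identityʳ b)) (trans (cong (b *_) (sym k≡1)) (trans (*-comm b k) b≡))
    where
    instance
      3a≢0 : NonZero (3 * a)
      3a≢0 = m*n≢0 3 a
    h₁ : 3 * a * b ≡ 9 * (a * x) + x * d
    h₁ = cancel (9 * (a * b) + b * d) (e a b d) h (f a b x d)
      where
      e : ∀ a b d → 3 * a * b + (9 * (a * b) + b * d) ≡ 12 * (a * b) + b * d
      e = solve-∀
      f : ∀ a b x d → 9 * (a * (b + x)) + (b + x) * d ≡ 9 * (a * x) + x * d + (9 * (a * b) + b * d)
      f = solve-∀
    3a∣x : 3 * a ∣ x
    3a∣x = coprime-divisor 3a⊥d (subst (3 * a ∣_) (*-comm x d) (∣m+n∣m⇒∣n (subst (3 * a ∣_) h₁ (m∣m*n b))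
      (subst (3 * a ∣_) (e a x) (m∣m*n (3 * x)))))
      where
      e : ∀ a x → 3 * a * (3 * x) ≡ 9 * (a * x)
      e = solve-∀
    k = quotient 3a∣x
    x≡ : x ≡ k * (3 * a)
    x≡ = m∣n⇒n≡quotient*m 3a∣x
    b≡k : b ≡ k * (9 * a + d)
    b≡k = *-cancelˡ-≡ _ _ (3 * a) (trans h₁ (trans (cong (λ x → 9 * (a * x) + x * d) x≡) (e a k d)))
      where
      e : ∀ a k d → 9 * (a * (k * (3 * a))) + k * (3 * a) * d ≡ 3 * a * (k * (9 * a + d))
      e = solve-∀
    k∣b : k ∣ b
    k∣b = subst (k ∣_) (sym b≡k) (m∣m*n (9 * a + d))
    k≡1 : k ≡ 1
    k≡1 = b⊥c (k∣b , ∣m∣n⇒∣m+n k∣b (subst (k ∣_) (sym x≡) (m∣m*n (3 * a))))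
    b≡ : k * b ≡ 9 * a + d
    b≡ = trans (cong₂ _*_ k≡1 b≡k) (trans (*-identityˡ _) (trans (cong (_* (9 * a + d)) k≡1) (*-identityˡ _)))
    x≡3a : x ≡ 3 * a
    x≡3a = trans x≡ (trans (cong (_* (3 * a)) k≡1) (*-identityˡ _))

  -- The equation is b (3a + d) = c (9a + 4d), and 9a + 4d = 3(3a + d) + d is coprime to 3a + d.
  -- Comparing coprime pairs gives c = 3a + d and b = 9a + 4d.
  split₃ : ∀ a b c d .{{_ : NonZero c}} .{{_ : NonZero d}} → Coprime (3 * a) d → Coprime b c →
    3 * (a * b) + b * d ≡ 9 * (a * c) + 4 * (c * d) → b ≡ 3 * c + d × c ≡ 3 * a + d
  split₃ a b c d 3a⊥d b⊥c h with ≤-total b (3 * c)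
  ... | inj₁ b≤3c = contradiction h (<⇒≢ (+-mono-≤-<
          (≤-trans (*-monoʳ-≤ 3 (*-monoʳ-≤ a b≤3c)) (≤-reflexive (e a c)))
          (≤-<-trans (*-monoˡ-≤ d b≤3c) (≤-<-trans (≤-reflexive (*-assoc 3 c d)) (*-monoˡ-< (c * d) {{m*n≢0 c d}} {3} {4} (s≤s (m≤m+n 3 0)))))))
    where
    e : ∀ a c → 3 * (a * (3 * c)) ≡ 9 * (a * c)
    e = solve-∀
  ... | inj₂ 3c≤b with ≤⇒∃+ 3c≤b
  ...   | x , refl = cong (3 * c +_) x≡d , trans c≡k (trans (cong (_* (3 * a + d)) k≡1) (*-identityˡ _))
    where
    h₁ : 3 * a * x + x * d ≡ c * d
    h₁ = cancel (9 * (a * c) + 3 * (c * d)) (e a c x d) h (f a c d)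
      where
      e : ∀ a c x d → 3 * a * x + x * d + (9 * (a * c) + 3 * (c * d)) ≡ 3 * (a * (3 * c + x)) + (3 * c + x) * d
      e = solve-∀
      f : ∀ a c d → 9 * (a * c) + 4 * (c * d) ≡ c * d + (9 * (a * c) + 3 * (c * d))
      f = solve-∀
    d∣x : d ∣ x
    d∣x = coprime-divisor (Coprimality.sym 3a⊥d) (∣m+n∣m⇒∣n (subst (d ∣_) (trans (sym h₁) (+-comm (3 * a * x) _)) (n∣m*n c)) (n∣m*n x))
    k = quotient d∣x
    x≡ : x ≡ k * d
    x≡ = m∣n⇒n≡quotient*m d∣x
    c≡k : c ≡ k * (3 * a + d)
    c≡k = *-cancelʳ-≡ _ _ d (trans (sym h₁) (trans (cong (λ x → 3 * a * x + x * d) x≡) (e a k d)))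
      where
      e : ∀ a k d → 3 * a * (k * d) + k * d * d ≡ k * (3 * a + d) * d
      e = solve-∀
    k∣c : k ∣ c
    k∣c = subst (k ∣_) (sym c≡k) (m∣m*n (3 * a + d))
    k≡1 : k ≡ 1
    k≡1 = b⊥c (∣m∣n⇒∣m+n (∣n⇒∣m*n 3 k∣c) (subst (k ∣_) (sym x≡) (m∣m*n d)) , k∣c)
    x≡d : x ≡ d
    x≡d = trans x≡ (trans (cong (_* d) k≡1) (*-identityˡ d))

  -- Modulo 4 the first equation makes γ even and δ odd. Modulo 8 the second then gives γ² = 4, and
  -- the first gives β² = 5.
  no-odd-solution₃ : ∀ {α β} γ δ → Odd α → Odd β → β * β ≡ 3 * (γ * γ) + δ * δ → ¬ γ * γ ≡ 3 * (α * α) + δ * δ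
  no-odd-solution₃ γ δ (odd i) (odd j) e f = unsolvable 8
    ((con 1 ⊕ con 2 ⊗ x₁) ² ≈ con 3 ⊗ x₂ ² ⊕ x₃ ² ∷ x₂ ² ≈ con 3 ⊗ (con 1 ⊕ con 2 ⊗ x₀) ² ⊕ x₃ ² ∷ [])
    (i ∷ j ∷ γ ∷ δ ∷ []) (e ∷ f ∷ [])

  3∤⇒coprime : ∀ {n} → ¬ 3 ∣ n → Coprime 3 n
  3∤⇒coprime = prime∤⇒coprime prime[3]

  -- One of p, q is even; halve it and refine. An even `p` leads through `split₂` to the original
  -- system with t = α. An even `q` leads through `split₃` to two equations that are impossible
  -- modulo 8.
  descend₂ : ∀ s p q m n .{{_ : NonZero s}} → Coprime p q → ¬ 3 ∣ q →
    2 * s ≡ p * q → s ≡ m * n → 3 * (p * p) + n * n ≡ q * q + 9 * (m * m) → ∃ λ t → Quadruple₂ t × t ∣ s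
  descend₂ s p q m n p⊥q 3∤q 2s≡pq s≡mn sum = from-half (halve p q s 2s≡pq)
    where
    -- In both cases δ divides `q`, so it is prime to 3.
    coprime-3a : ∀ α δ → Coprime α δ → ¬ 3 ∣ δ → Coprime (3 * (α * α)) (δ * δ)
    coprime-3a α δ αδ 3∤δ = Coprimality.sym (coprime-* (Coprimality.sym (coprime-sq (3∤⇒coprime 3∤δ))) (coprime-sqs (Coprimality.sym αδ)))
    Result = ∃ λ t → Quadruple₂ t × t ∣ s
    from-half  : Halved p q s → Result
    from-fourˡ : ∀ h → h * q ≡ s → Refinement h q m n → Coprime (2 * h) q → 3 * (2 * h * (2 * h)) + n * n ≡ q * q + 9 * (m * m) → Result
    from-fourʳ : ∀ h → p * h ≡ s → Refinement p h m n → Coprime p (2 * h) → ¬ 3 ∣ 2 * h → 3 * (p * p) + n * n ≡ 2 * h * (2 * h) + 9 * (m * m) → Result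
    from-half (halvedˡ h refl hq≡s) = from-fourˡ h hq≡s (refine h q m n {{m*n≢0⇒m≢0 h {{subst NonZero (sym hq≡s) (≢-nonZero (≢-nonZero⁻¹ s))}}}} (trans hq≡s s≡mn)) p⊥q sum
    from-half (halvedʳ h refl ph≡s) = from-fourʳ h ph≡s (refine p h m n {{m*n≢0⇒m≢0 p {{subst NonZero (sym ph≡s) (≢-nonZero (≢-nonZero⁻¹ s))}}}} (trans ph≡s s≡mn)) p⊥q 3∤q sum
    from-fourˡ h hq≡s (refinement α β γ δ refl refl refl refl βγ) p⊥q sum = conclude (split₂ (α * α) (β * β) (γ * γ) (δ * δ) {{m*n≢0 α α}} {{m*n≢0 β β}}
              (coprime-3a α δ αδ λ 3∣δ → 3∤q (∣n⇒∣m*n γ 3∣δ)) (coprime-sqs βγ) eq)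
      where
      instance
        αβγδ≢0 : NonZero (α * β * (γ * δ))
        αβγδ≢0 = subst NonZero (sym hq≡s) (≢-nonZero (≢-nonZero⁻¹ s))
        αβ≢0 : NonZero (α * β)
        αβ≢0 = m*n≢0⇒m≢0 (α * β) {{αβγδ≢0}}
        α≢0 : NonZero α
        α≢0 = m*n≢0⇒m≢0 α {{αβ≢0}}
        β≢0 : NonZero β
        β≢0 = m*n≢0⇒n≢0 α {{αβ≢0}}
      αδ : Coprime α δ
      αδ = ∣-coprime (m∣m*n β) (Coprimality.sym (∣-coprime (n∣m*n γ) (Coprimality.sym (∣-coprime (n∣m*n 2) p⊥q))))
      eq : 12 * (α * α * (β * β)) + β * β * (δ * δ) ≡ 9 * (α * α * (γ * γ)) + γ * γ * (δ * δ)
      eq = trans (e α β δ) (trans sum (f α γ δ))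
        where
        e : ∀ α β δ → 12 * (α * α * (β * β)) + β * β * (δ * δ) ≡ 3 * (2 * (α * β) * (2 * (α * β))) + β * δ * (β * δ)
        e = solve-∀
        f : ∀ α γ δ → γ * δ * (γ * δ) + 9 * (α * γ * (α * γ)) ≡ 9 * (α * α * (γ * γ)) + γ * γ * (δ * δ)
        f = solve-∀
      conclude : γ * γ ≡ β * β + 3 * (α * α) × β * β ≡ 9 * (α * α) + δ * δ → _
      conclude (c≡ , b≡) = α , quadruple β γ δ
        (λ {i} (i∣β , i∣α) → coprime-sq βγ (i∣β , subst (i ∣_) (sym c≡) (∣m∣n⇒∣m+n (∣m⇒∣m*n β i∣β) (∣n⇒∣m*n 3 (∣m⇒∣m*n α i∣α)))))
        (sym c≡) b≡ , subst (α ∣_) hq≡s (∣m⇒∣m*n (γ * δ) (m∣m*n β))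
    from-fourʳ h ph≡s (refinement α β γ δ refl refl refl refl βγ) p⊥q 3∤q sum = conclude (split₃ (α * α) (β * β) (γ * γ) (δ * δ) {{m*n≢0 γ γ}} {{m*n≢0 δ δ}}
              (coprime-3a α δ αδ λ 3∣δ → 3∤q (∣n⇒∣m*n 2 (∣n⇒∣m*n γ 3∣δ))) (coprime-sqs βγ) eq)
      where
      instance
        αβγδ≢0 : NonZero (α * β * (γ * δ))
        αβγδ≢0 = subst NonZero (sym ph≡s) (≢-nonZero (≢-nonZero⁻¹ s))
        γδ≢0 : NonZero (γ * δ)
        γδ≢0 = m*n≢0⇒n≢0 (α * β) {{αβγδ≢0}}
        γ≢0 : NonZero γ
        γ≢0 = m*n≢0⇒m≢0 γ {{γδ≢0}}
        δ≢0 : NonZero δ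
        δ≢0 = m*n≢0⇒n≢0 γ {{γδ≢0}}
      αδ : Coprime α δ
      αδ = ∣-coprime (m∣m*n β) (Coprimality.sym (∣-coprime (∣n⇒∣m*n 2 (n∣m*n γ)) (Coprimality.sym p⊥q)))
      αβ-odd : Odd (α * β)
      αβ-odd = coprime-even⇒odd (γ * δ) p⊥q
      eq : 3 * (α * α * (β * β)) + β * β * (δ * δ) ≡ 9 * (α * α * (γ * γ)) + 4 * (γ * γ * (δ * δ))
      eq = trans (e α β δ) (trans sum (f α γ δ))
        where
        e : ∀ α β δ → 3 * (α * α * (β * β)) + β * β * (δ * δ) ≡ 3 * (α * β * (α * β)) + β * δ * (β * δ)
        e = solve-∀
        f : ∀ α γ δ → 2 * (γ * δ) * (2 * (γ * δ)) + 9 * (α * γ * (α * γ)) ≡ 9 * (α * α * (γ * γ)) + 4 * (γ * γ * (δ * δ))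
        f = solve-∀
      conclude : β * β ≡ 3 * (γ * γ) + δ * δ × γ * γ ≡ 3 * (α * α) + δ * δ → _
      conclude (b≡ , c≡) = ⊥-elim (no-odd-solution₃ γ δ (odd-factorˡ {α} {β} αβ-odd) (odd-factorʳ {α} αβ-odd) b≡ c≡)

  -- For odd `t`, residues modulo 4 force `a` odd and b = 2i, c = 2l; modulo 8 also `i` is odd.
  -- Eliminating `a` and dividing by 4 leaves i² = l² + 3t², which fails modulo 4.
  even-t₂ : ∀ a b c t → Coprime a t → a * a + 3 * (t * t) ≡ b * b → a * a ≡ 9 * (t * t) + c * c → ∃ λ s → t ≡ 2 * s
  even-t₂ a b c t a⊥t eq₁ eq₂ with parityView t
  ... | even s = s , refl
  ... | odd k with parityView a
  ...   | even j = ⊥-elim (unsolvable 4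
          ((con 2 ⊗ x₀) ² ⊕ con 3 ⊗ (con 1 ⊕ con 2 ⊗ x₁) ² ≈ x₂ ² ∷ []) (j ∷ k ∷ b ∷ []) (eq₁ ∷ []))
  ...   | odd j with parityView b
  ...     | odd i = ⊥-elim (unsolvable 4
          ((con 1 ⊕ con 2 ⊗ x₀) ² ⊕ con 3 ⊗ (con 1 ⊕ con 2 ⊗ x₁) ² ≈ (con 1 ⊕ con 2 ⊗ x₂) ² ∷ []) (j ∷ k ∷ i ∷ []) (eq₁ ∷ []))
  ...     | even i with parityView c
  ...       | odd l = ⊥-elim (unsolvable 4
          ((con 1 ⊕ con 2 ⊗ x₀) ² ≈ con 9 ⊗ (con 1 ⊕ con 2 ⊗ x₁) ² ⊕ (con 1 ⊕ con 2 ⊗ x₂) ² ∷ []) (j ∷ k ∷ l ∷ []) (eq₂ ∷ []))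
  ...       | even l with parityView i
  ...         | even i′ = ⊥-elim (unsolvable 8
          ((con 1 ⊕ con 2 ⊗ x₀) ² ⊕ con 3 ⊗ (con 1 ⊕ con 2 ⊗ x₁) ² ≈ (con 2 ⊗ (con 2 ⊗ x₂)) ² ∷ []) (j ∷ k ∷ i′ ∷ []) (eq₁ ∷ []))
  ...         | odd i′ = ⊥-elim (unsolvable 4
          ((con 1 ⊕ con 2 ⊗ x₀) ² ≈ x₁ ² ⊕ con 3 ⊗ (con 1 ⊕ con 2 ⊗ x₂) ² ∷ []) (i′ ∷ l ∷ k ∷ [])
          (i²≡l²+3t² (1 + 2 * i′) l (1 + 2 * j) (1 + 2 * k) eq₁ eq₂ ∷ []))
    where
    i²≡l²+3t² : ∀ i l a t → a * a + 3 * (t * t) ≡ 2 * i * (2 * i) → a * a ≡ 9 * (t * t) + 2 * l * (2 * l) → i * i ≡ l * l + 3 * (t * t)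
    i²≡l²+3t² i l a t e f = *-cancelˡ-≡ _ _ 4 (trans (g i) (trans (sym e) (trans (cong (_+ 3 * (t * t)) f) (h l t))))
      where
      g : ∀ i → 4 * (i * i) ≡ 2 * i * (2 * i)
      g = solve-∀
      h : ∀ l t → 9 * (t * t) + 2 * l * (2 * l) + 3 * (t * t) ≡ 4 * (l * l + 3 * (t * t))
      h = solve-∀

  -- If 3 divides `a` it divides `b`; dividing the equation by 3 then shows that 3 divides t²,
  -- against coprimality.
  3∤a : ∀ a b t → Coprime a t → a * a + 3 * (t * t) ≡ b * b → ¬ 3 ∣ a
  3∤a a b t a⊥t e 3∣a = case (a⊥t (3∣a , 3∣t)) of λ ()
    where
    j = quotient 3∣a
    a≡ : a ≡ 3 * j
    a≡ = m∣n⇒n≡m*quotient 3∣a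
    3∣b : 3 ∣ b
    3∣b = prime∣x² prime[3] b (subst (3 ∣_) e (∣m∣n⇒∣m+n (∣m⇒∣m*n a 3∣a) (m∣m*n (t * t))))
    i = quotient 3∣b
    t²≡ : t * t + 3 * (j * j) ≡ 3 * (i * i)
    t²≡ = *-cancelˡ-≡ _ _ 3 (trans (g j t) (trans (cong (λ a → a * a + 3 * (t * t)) (sym a≡)) (trans e (trans (cong (λ b → b * b) (m∣n⇒n≡m*quotient 3∣b)) (h i)))))
      where
      g : ∀ j t → 3 * (t * t + 3 * (j * j)) ≡ 3 * j * (3 * j) + 3 * (t * t)
      g = solve-∀
      h : ∀ i → 3 * i * (3 * i) ≡ 3 * (3 * (i * i))
      h = solve-∀
    3∣t : 3 ∣ t
    3∣t = prime∣x² prime[3] t (∣m+n∣m⇒∣n (subst (3 ∣_) (trans (sym t²≡) (+-comm (t * t) _)) (m∣m*n (i * i))) (m∣m*n (j * j)))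

  -- 3p² + n² = q² + m² forces q² + m² ≡ 0 modulo 3 as soon as 3 ∣ n.
  3∣m : ∀ p q m n s → 3 * s ≡ m * n → 3 * (p * p) + n * n ≡ q * q + m * m → ¬ 3 ∣ q → 3 ∣ m
  3∣m p q m n s 3s≡mn e 3∤q with euclidsLemma m n prime[3] (subst (3 ∣_) 3s≡mn (m∣m*n s))
  ... | inj₁ 3∣m = 3∣m
  ... | inj₂ 3∣n = contradiction (q-multiple (q % 3) refl (m%n<n q 3)) 3∤q
    where
    l = quotient 3∣n
    e′ : 3 * (p * p) + 3 * l * (3 * l) ≡ (q % 3 + q / 3 * 3) * (q % 3 + q / 3 * 3) + m * m
    e′ = trans (cong (λ n → 3 * (p * p) + n * n) (sym (m∣n⇒n≡m*quotient 3∣n))) (trans e (cong (λ q → q * q + m * m) (m≡m%n+[m/n]*n q 3)))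
    q-multiple : ∀ r → q % 3 ≡ r → r < 3 → 3 ∣ q
    q-multiple 0 r≡ _ = m%n≡0⇒n∣m q 3 r≡
    q-multiple 1 r≡ _ = ⊥-elim (unsolvable 3
      (con 3 ⊗ x₀ ² ⊕ (con 3 ⊗ x₁) ² ≈ (con 1 ⊕ x₂ ⊗ con 3) ² ⊕ x₃ ² ∷ []) (p ∷ l ∷ q / 3 ∷ m ∷ [])
      (subst (λ r → 3 * (p * p) + 3 * l * (3 * l) ≡ (r + q / 3 * 3) * (r + q / 3 * 3) + m * m) r≡ e′ ∷ []))
    q-multiple 2 r≡ _ = ⊥-elim (unsolvable 3
      (con 3 ⊗ x₀ ² ⊕ (con 3 ⊗ x₁) ² ≈ (con 2 ⊕ x₂ ⊗ con 3) ² ⊕ x₃ ² ∷ []) (p ∷ l ∷ q / 3 ∷ m ∷ [])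
      (subst (λ r → 3 * (p * p) + 3 * l * (3 * l) ≡ (r + q / 3 * 3) * (r + q / 3 * 3) + m * m) r≡ e′ ∷ []))
    q-multiple (suc (suc (suc _))) _ (s≤s (s≤s (s≤s ())))

  -- The last argument says c = ±(3p² - q²); the sign tells which of (b + c)/2 and (b - c)/2 is 3p².
  data ThreeSplit (c t b : ℕ) : Set where
    threeSplit : ∀ p q → b ≡ 3 * (p * p) + q * q → t ≡ p * q → Coprime p q →
      c + q * q ≡ 3 * (p * p) ⊎ c + 3 * (p * p) ≡ q * q → ThreeSplit c t b

  -- The product of (b + c)/2 and (b - c)/2 is 3t². The factors are coprime, so one is a square and
  -- the other three times a square.
  splitDifference₃ : ∀ {c t b} .{{_ : NonZero t}} → Odd c → Odd b → Coprime (c * c) (3 * (t * t)) → c * c + 12 * (t * t) ≡ b * b → ThreeSplit c t b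
  splitDifference₃ {c} {t} {b} c-odd b-odd c²⊥3t² e with odd-difference b-odd c-odd
      (square-cancel-≤ (≤-trans (m≤m+n (c * c) _) (≤-reflexive e)))
  ... | y , refl = by-3 (euclidsLemma (c + y) y prime[3] (subst (3 ∣_) (sym xy≡3t²) (m∣m*n (t * t))))
    where
    xy≡3t² : (c + y) * y ≡ 3 * (t * t)
    xy≡3t² = *-cancelˡ-≡ _ _ 4 (cancel (c * c) (f c y) (sym e) (g c t))
      where
      f : ∀ c y → 4 * ((c + y) * y) + c * c ≡ (c + 2 * y) * (c + 2 * y)
      f = solve-∀
      g : ∀ c t → c * c + 12 * (t * t) ≡ 4 * (3 * (t * t)) + c * c
      g = solve-∀
    x⊥y : Coprime (c + y) y
    x⊥y {i} (i∣x , i∣y) = c²⊥3t²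
      ( ∣m⇒∣m*n c (∣m+n∣m⇒∣n (subst (i ∣_) (+-comm c y) i∣x) i∣y)
      , subst (i ∣_) xy≡3t² (∣n⇒∣m*n (c + y) i∣y))
    h : ∀ c y → c + 2 * y ≡ c + y + y
    h = solve-∀
    by-3 : 3 ∣ c + y ⊎ 3 ∣ y → ThreeSplit c t (c + 2 * y)
    by-3 (inj₁ 3∣x) = conclude (coprime-factors-of-square x′ y t {{m*n≢0⇒m≢0 x′ {{subst NonZero (sym x′y≡t²) (m*n≢0 t t)}}}}
        (∣-coprime (quotient-∣ 3∣x) x⊥y) x′y≡t²)
      where
      x′ = quotient 3∣x
      x≡ : c + y ≡ 3 * x′
      x≡ = m∣n⇒n≡m*quotient 3∣x
      x′y≡t² : x′ * y ≡ t * t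
      x′y≡t² = *-cancelˡ-≡ _ _ 3 (trans (sym (*-assoc 3 x′ y)) (trans (cong (_* y) (sym x≡)) xy≡3t²))
      conclude : (∃₂ λ p q → x′ ≡ p * p × y ≡ q * q × t ≡ p * q) → ThreeSplit c t (c + 2 * y)
      conclude (p , q , x′≡p² , y≡q² , t≡pq) = threeSplit p q
        (trans (h c y) (cong₂ _+_ x≡3p² y≡q²)) t≡pq
        (λ {i} (i∣p , i∣q) → x⊥y (subst (i ∣_) (sym x≡3p²) (∣n⇒∣m*n 3 (∣m⇒∣m*n p i∣p)) , subst (i ∣_) (sym y≡q²) (∣m⇒∣m*n q i∣q)))
        (inj₁ (trans (cong (c +_) (sym y≡q²)) x≡3p²))
        where
        x≡3p² = trans x≡ (cong (3 *_) x′≡p²)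
    by-3 (inj₂ 3∣y) = conclude (coprime-factors-of-square y′ (c + y) t {{m*n≢0⇒m≢0 y′ {{subst NonZero (sym y′x≡t²) (m*n≢0 t t)}}}}
        (∣-coprime (quotient-∣ 3∣y) (Coprimality.sym x⊥y)) y′x≡t²)
      where
      y′ = quotient 3∣y
      y≡ : y ≡ 3 * y′
      y≡ = m∣n⇒n≡m*quotient 3∣y
      y′x≡t² : y′ * (c + y) ≡ t * t
      y′x≡t² = *-cancelˡ-≡ _ _ 3 (trans (sym (*-assoc 3 y′ (c + y))) (trans (cong (_* (c + y)) (sym y≡)) (trans (*-comm y (c + y)) xy≡3t²)))
      conclude : (∃₂ λ p q → y′ ≡ p * p × c + y ≡ q * q × t ≡ p * q) → ThreeSplit c t (c + 2 * y)
      conclude (p , q , y′≡p² , x≡q² , t≡pq) = threeSplit p q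
        (trans (h c y) (trans (+-comm (c + y) y) (cong₂ _+_ y≡3p² x≡q²))) t≡pq
        (λ {i} (i∣p , i∣q) → x⊥y (subst (i ∣_) (sym x≡q²) (∣m⇒∣m*n q i∣q) , subst (i ∣_) (sym y≡3p²) (∣n⇒∣m*n 3 (∣m⇒∣m*n p i∣p))))
        (inj₂ (trans (cong (c +_) (sym y≡3p²)) x≡q²))
        where
        y≡3p² = trans y≡ (cong (3 *_) y′≡p²)

  -- For t = 2s, a² = c² + 4(3s)² is a primitive Pythagorean triple and b² - c² = 12t². Eliminating
  -- `c` from the two parametrisations leaves 3p² + n² = q² + m² with pq = 2s and mn = 3s, where the
  -- sign of 3p² - q² decides whether m and n are exchanged. The factor 3 of mn lies in m, as 3 does
  -- not divide q.
  step₂ : ∀ t .{{_ : NonZero t}} → Quadruple₂ t → ∃ λ t′ → Quadruple₂ t′ × NonZero t′ × t′ < t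
  step₂ t (quadruple a b c a⊥t eq₁ eq₂) with even-t₂ a b c t a⊥t eq₁ eq₂
  ... | s , refl = conclude
      (oddPythagorean {t = 3 * s} {{m*n≢0 3 s}} c-odd a-odd c⊥3s (trans (f c s) (sym eq₂)))
      (splitDifference₃ {t = 2 * s} c-odd b-odd (coprime-* (Coprimality.sym (coprime-sq (3∤⇒coprime 3∤c))) (coprime-sqs c⊥t)) (trans (g c (2 * s)) (trans (cong (_+ 3 * (2 * s * (2 * s))) (sym eq₂)) eq₁)))
    where
    Smaller = ∃ λ t′ → Quadruple₂ t′ × NonZero t′ × t′ < 2 * s
    instance
      s≢0 : NonZero s
      s≢0 = m*n≢0⇒n≢0 2
    f : ∀ c s → c * c + 4 * (3 * s * (3 * s)) ≡ 9 * (2 * s * (2 * s)) + c * c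
    f = solve-∀
    g : ∀ c t → c * c + 12 * (t * t) ≡ 9 * (t * t) + c * c + 3 * (t * t)
    g = solve-∀
    a-odd : Odd a
    a-odd = coprime-even⇒odd s a⊥t
    b-odd : Odd b
    b-odd = odd-b (parityView b) a-odd eq₁
      where
      odd-b : ∀ {a b} → ParityView b → Odd a → a * a + 3 * (2 * s * (2 * s)) ≡ b * b → Odd b
      odd-b (odd j)  _       _ = odd j
      odd-b (even j) (odd i) e = ⊥-elim (unsolvable 4
        ((con 1 ⊕ con 2 ⊗ x₀) ² ⊕ con 3 ⊗ (con 2 ⊗ x₁) ² ≈ (con 2 ⊗ x₂) ² ∷ []) (i ∷ s ∷ j ∷ []) (e ∷ []))
    c-odd : Odd c
    c-odd = odd-c (parityView c) a-odd eq₂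
      where
      odd-c : ∀ {a c} → ParityView c → Odd a → a * a ≡ 9 * (2 * s * (2 * s)) + c * c → Odd c
      odd-c (odd j)  _       _ = odd j
      odd-c (even j) (odd i) e = ⊥-elim (unsolvable 4
        ((con 1 ⊕ con 2 ⊗ x₀) ² ≈ con 9 ⊗ (con 2 ⊗ x₁) ² ⊕ (con 2 ⊗ x₂) ² ∷ []) (i ∷ s ∷ j ∷ []) (e ∷ []))
    ¬3∣a : ¬ 3 ∣ a
    ¬3∣a = 3∤a a b (2 * s) a⊥t eq₁
    3∤c : ¬ 3 ∣ c
    3∤c 3∣c = ¬3∣a (prime∣x² prime[3] a (subst (3 ∣_) (sym eq₂) (∣m∣n⇒∣m+n (∣m⇒∣m*n (2 * s * (2 * s)) (m∣m*n {3} 3)) (∣m⇒∣m*n c 3∣c))))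
    c⊥t : Coprime c (2 * s)
    c⊥t {i} (i∣c , i∣t) = Coprimality.sym (coprime-sq (Coprimality.sym a⊥t))
      (subst (i ∣_) (sym eq₂) (∣m∣n⇒∣m+n (∣n⇒∣m*n 9 (∣m⇒∣m*n (2 * s) i∣t)) (∣m⇒∣m*n c i∣c)) , i∣t)
    c⊥3s : Coprime c (3 * s)
    c⊥3s = coprime-* {c} {3} {s} (Coprimality.sym (3∤⇒coprime 3∤c)) (Coprimality.sym (∣-coprime (n∣m*n 2) (Coprimality.sym c⊥t)))
    conclude : OddTriple c (3 * s) a → ThreeSplit c (2 * s) b → Smaller
    conclude (oddTriple m n c+n²≡m² _ 3s≡mn _) (threeSplit p q b≡ t≡pq p⊥q which) = by-sign which
      where
      3∤q : ¬ 3 ∣ q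
      3∤q 3∣q = ¬3∣a (prime∣x² prime[3] a (∣m+n∣m⇒∣n (subst (3 ∣_) (trans (sym eq₁) (+-comm (a * a) _)) (∣m⇒∣m*n b 3∣b)) (m∣m*n (2 * s * (2 * s)))))
        where
        3∣b : 3 ∣ b
        3∣b = subst (3 ∣_) (sym b≡) (∣m∣n⇒∣m+n (m∣m*n (p * p)) (∣m⇒∣m*n q 3∣q))
      finish : ∀ m n → 3 * s ≡ m * n → 3 * (p * p) + n * n ≡ q * q + m * m → Smaller
      finish m n 3s≡mn e =
        let d  = 3∣m p q m n s 3s≡mn e 3∤q
            m′ = quotient d
            m≡ = m∣n⇒n≡m*quotient d
            s≡ = *-cancelˡ-≡ s (m′ * n) 3 (trans 3s≡mn (trans (cong (_* n) m≡) (*-assoc 3 m′ n)))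
            t′ , quad , t′∣s = descend₂ s p q m′ n p⊥q 3∤q t≡pq s≡
              (trans e (cong (q * q +_) (trans (cong (λ m → m * m) m≡) (h m′))))
        in t′ , quad , ∣-nonZero t′∣s , t∣s⇒t<2s t′∣s
        where
        h : ∀ m → 3 * m * (3 * m) ≡ 9 * (m * m)
        h = solve-∀
      by-sign : c + q * q ≡ 3 * (p * p) ⊎ c + 3 * (p * p) ≡ q * q → Smaller
      by-sign (inj₁ c+q²) = finish m n 3s≡mn (trans (cong (_+ n * n) (sym c+q²)) (trans (i c (q * q) (n * n)) (cong (q * q +_) c+n²≡m²)))
        where
        i : ∀ c q n → c + q + n ≡ q + (c + n)
        i = solve-∀
      by-sign (inj₂ c+3p²) = finish n m (trans 3s≡mn (*-comm m n)) (trans (cong (3 * (p * p) +_) (sym c+n²≡m²)) (trans (i c (3 * (p * p)) (n * n)) (cong (_+ n * n) c+3p²)))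
        where
        i : ∀ c p n → p + (c + n) ≡ c + p + n
        i = solve-∀

  no-quadruple₂ : ∀ t .{{_ : NonZero t}} → ¬ Quadruple₂ t
  no-quadruple₂ t = go t (<-wellFounded t)
    where
    go : ∀ t → Acc _<_ t → .{{_ : NonZero t}} → ¬ Quadruple₂ t
    go t (acc smaller) quad with step₂ t quad
    ... | t′ , quad′ , t′≢0 , t′<t = go t′ (smaller t′<t) {{t′≢0}} quad′

  -- Squares are 0 or 1 modulo 4. The summand 0 is the `n` of `integral-root`, which supplies such
  -- an `m`.
  3-nonsquare : ∀ m → ¬ m * m + 0 ≡ 3
  3-nonsquare m m²≡3 = unsolvable 4 (x₀ ² ⊕ con 0 ≈ con 3 ∷ []) (m ∷ []) (m²≡3 ∷ [])

  odd-* : ∀ {m n} → Odd m → Odd n → Odd (m * n)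
  odd-* (odd i) (odd j) = subst Odd (eq i j) (odd (i + j + 2 * (i * j)))
    where
    eq : ∀ i j → 1 + 2 * (i + j + 2 * (i * j)) ≡ (1 + 2 * i) * (1 + 2 * j)
    eq = solve-∀

  odd+even : ∀ {m} → Odd m → ∀ k → Odd (m + 2 * k)
  odd+even (odd i) k = subst Odd (cong suc (*-distribˡ-+ 2 i k)) (odd (i + k))

  odd⇒nonZero : ∀ {n} → Odd n → NonZero n
  odd⇒nonZero (odd k) = _

  odd≢even : ∀ {n} → Odd n → ∀ l → n ≢ 2 * l
  odd≢even (odd k) l e = unsolvable 2 (con 1 ⊕ con 2 ⊗ x₀ ≈ con 2 ⊗ x₁ ∷ []) (k ∷ l ∷ []) (e ∷ [])

-- From rational to natural solutions.

module Rationals where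

  open import Data.Integer.Base as ℤ using (ℤ; +_; -[1+_])
  import Data.Integer.Properties as ℤ
  open import Data.Nat.Base as ℕ using (ℕ; suc; NonZero)
  open import Data.Nat.Coprimality as Coprimality using (Coprime)
  open import Data.Nat.Divisibility as ℕ using (_∣_)
  import Data.Nat.Properties as ℕ
  open import Data.Product.Base using (_×_; _,_; ∃; proj₁; proj₂)
  open import Data.Rational.Base as ℚ using (ℚ; mkℚ; 0ℚ; 1ℚ; _+_; _-_; _*_; 1/_; ↥_; ↧ₙ_; toℚᵘ)
  import Data.Rational.Properties as ℚ
  open import Data.Rational.Solver
  open import Data.Rational.Unnormalised.Base as ℚᵘ using (ℚᵘ; mkℚᵘ; *≡*; _≃_)
  import Data.Rational.Unnormalised.Properties as ℚᵘ
  open import Relation.Binary.PropositionalEquality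
  open import Relation.Nullary using (¬_)
  open import Defs using (fromℕ)
  open +-*-Solver using (solve; con; _:+_; _:*_; _:=_)
  open Descent using (coprime-sq; quadruple; no-quadruple₁; no-quadruple₂)

  toℚᵘ-fromℕ : ∀ n → toℚᵘ (fromℕ n) ≃ mkℚᵘ (+ n) 0
  toℚᵘ-fromℕ n = ℚ.toℚᵘ-fromℚᵘ (mkℚᵘ (+ n) 0)

  fromℕ-+ : ∀ m n → fromℕ (m ℕ.+ n) ≡ fromℕ m + fromℕ n
  fromℕ-+ m n = ℚ.toℚᵘ-injective (begin
    toℚᵘ (fromℕ (m ℕ.+ n))             ≈⟨ toℚᵘ-fromℕ (m ℕ.+ n) ⟩
    mkℚᵘ (+ (m ℕ.+ n)) 0               ≈⟨ *≡* (cong (ℤ._* (+ 1)) (sym (cong₂ ℤ._+_ (ℤ.*-identityʳ (+ m)) (ℤ.*-identityʳ (+ n))))) ⟩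
    mkℚᵘ (+ m) 0 ℚᵘ.+ mkℚᵘ (+ n) 0     ≈⟨ ℚᵘ.+-cong (toℚᵘ-fromℕ m) (toℚᵘ-fromℕ n) ⟨
    toℚᵘ (fromℕ m) ℚᵘ.+ toℚᵘ (fromℕ n) ≈⟨ ℚ.toℚᵘ-homo-+ (fromℕ m) (fromℕ n) ⟨
    toℚᵘ (fromℕ m + fromℕ n)           ∎)
    where open ℚᵘ.≃-Reasoning

  fromℕ-* : ∀ m n → fromℕ (m ℕ.* n) ≡ fromℕ m * fromℕ n
  fromℕ-* m n = ℚ.toℚᵘ-injective (begin
    toℚᵘ (fromℕ (m ℕ.* n))             ≈⟨ toℚᵘ-fromℕ (m ℕ.* n) ⟩
    mkℚᵘ (+ (m ℕ.* n)) 0               ≈⟨ *≡* (cong (ℤ._* (+ 1)) (ℤ.pos-* m n)) ⟩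
    mkℚᵘ (+ m) 0 ℚᵘ.* mkℚᵘ (+ n) 0     ≈⟨ ℚᵘ.*-cong (toℚᵘ-fromℕ m) (toℚᵘ-fromℕ n) ⟨
    toℚᵘ (fromℕ m) ℚᵘ.* toℚᵘ (fromℕ n) ≈⟨ ℚ.toℚᵘ-homo-* (fromℕ m) (fromℕ n) ⟨
    toℚᵘ (fromℕ m * fromℕ n)           ∎)
    where open ℚᵘ.≃-Reasoning

  fromℕ-injective : ∀ {m n} → fromℕ m ≡ fromℕ n → m ≡ n
  fromℕ-injective {m} {n} e with ℚᵘ.≃-trans (ℚᵘ.≃-sym (toℚᵘ-fromℕ m)) (ℚᵘ.≃-trans (ℚᵘ.≃-reflexive (cong toℚᵘ e)) (toℚᵘ-fromℕ n))
  ... | *≡* p = ℤ.+-injective (trans (sym (ℤ.*-identityʳ (+ m))) (trans p (ℤ.*-identityʳ (+ n))))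

  i*i≡∣i∣² : ∀ i → i ℤ.* i ≡ + (ℤ.∣ i ∣ ℕ.* ℤ.∣ i ∣)
  i*i≡∣i∣² (+ n)    = sym (ℤ.pos-* n n)
  i*i≡∣i∣² -[1+ n ] = refl

  -- Only squares of the unknowns occur in the two systems, so numerators can enter through their
  -- absolute values.
  numerator-denominator : ∀ x → x * x * (fromℕ (↧ₙ x) * fromℕ (↧ₙ x)) ≡ fromℕ (ℤ.∣ ↥ x ∣ ℕ.* ℤ.∣ ↥ x ∣)
  numerator-denominator x@(mkℚ i d _) = ℚ.toℚᵘ-injective (begin
    toℚᵘ (x * x * (δ * δ))                               ≈⟨ ℚ.toℚᵘ-homo-* (x * x) (δ * δ) ⟩
    toℚᵘ (x * x) ℚᵘ.* toℚᵘ (δ * δ)                       ≈⟨ ℚᵘ.*-cong (ℚ.toℚᵘ-homo-* x x) (ℚ.toℚᵘ-homo-* δ δ) ⟩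
    mkℚᵘ i d ℚᵘ.* mkℚᵘ i d ℚᵘ.* (toℚᵘ δ ℚᵘ.* toℚᵘ δ)     ≈⟨ ℚᵘ.*-congˡ {mkℚᵘ i d ℚᵘ.* mkℚᵘ i d} (ℚᵘ.*-cong (toℚᵘ-fromℕ (suc d)) (toℚᵘ-fromℕ (suc d))) ⟩
    mkℚᵘ i d ℚᵘ.* mkℚᵘ i d ℚᵘ.* (D ℚᵘ.* D)               ≈⟨ *≡* (trans (ℤ.*-identityʳ _) (cong₂ ℤ._*_ (i*i≡∣i∣² i) (sym (ℤ.*-identityʳ _)))) ⟩
    mkℚᵘ (+ (ℤ.∣ i ∣ ℕ.* ℤ.∣ i ∣)) 0                     ≈⟨ toℚᵘ-fromℕ _ ⟨
    toℚᵘ (fromℕ (ℤ.∣ i ∣ ℕ.* ℤ.∣ i ∣))                   ∎)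
    where
    open ℚᵘ.≃-Reasoning
    δ = fromℕ (suc d)
    D = mkℚᵘ (+ suc d) 0

  -- A rational root of a monic polynomial is integral: in p² + nq² = kq² the denominator q divides
  -- p² and is coprime to it.
  integral-root : ∀ x n k → x * x + fromℕ n ≡ fromℕ k → ∃ λ m → m ℕ.* m ℕ.+ n ≡ k
  integral-root x@(mkℚ i d i⊥d) n k e = p , at-1 q≡1
    where
    q = suc d
    p = ℤ.∣ i ∣
    p⊥q : Coprime p q
    p⊥q = Coprimality.recompute i⊥d
    eq : p ℕ.* p ℕ.+ n ℕ.* (q ℕ.* q) ≡ k ℕ.* (q ℕ.* q)
    eq = fromℕ-injective (begin
      fromℕ (p ℕ.* p ℕ.+ n ℕ.* (q ℕ.* q))             ≡⟨ fromℕ-+ (p ℕ.* p) _ ⟩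
      fromℕ (p ℕ.* p) + fromℕ (n ℕ.* (q ℕ.* q))       ≡⟨ cong₂ _+_ (numerator-denominator x) (trans (cong (fromℕ n *_) (sym (fromℕ-* q q))) (sym (fromℕ-* n _))) ⟨
      x * x * (fromℕ q * fromℕ q) + fromℕ n * (fromℕ q * fromℕ q) ≡⟨ ℚ.*-distribʳ-+ (fromℕ q * fromℕ q) (x * x) (fromℕ n) ⟨
      (x * x + fromℕ n) * (fromℕ q * fromℕ q)         ≡⟨ cong₂ _*_ e (sym (fromℕ-* q q)) ⟩
      fromℕ k * fromℕ (q ℕ.* q)                       ≡⟨ fromℕ-* k (q ℕ.* q) ⟨
      fromℕ (k ℕ.* (q ℕ.* q))                         ∎)
      where open ≡-Reasoning
    q∣p² : q ∣ p ℕ.* p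
    q∣p² = ℕ.∣m+n∣m⇒∣n (subst (q ∣_) (trans (sym eq) (ℕ.+-comm (p ℕ.* p) _)) (ℕ.∣n⇒∣m*n k (ℕ.m∣m*n q))) (ℕ.∣n⇒∣m*n n (ℕ.m∣m*n q))
    q≡1 : q ≡ 1
    q≡1 = Coprimality.sym (coprime-sq (Coprimality.sym p⊥q)) (q∣p² , ℕ.∣-refl)
    at-1 : q ≡ 1 → p ℕ.* p ℕ.+ n ≡ k
    at-1 q≡1 = trans (cong (p ℕ.* p ℕ.+_) (sym (ℕ.*-identityʳ n))) (trans (subst (λ q → p ℕ.* p ℕ.+ n ℕ.* (q ℕ.* q) ≡ k ℕ.* (q ℕ.* q)) q≡1 eq) (ℕ.*-identityʳ k))

  cancel-*ˡ : ∀ {a x y} → a ≢ 0ℚ → a * x ≡ a * y → x ≡ y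
  cancel-*ˡ {a} {x} {y} a≢0 e = begin
    x             ≡⟨ ℚ.*-identityˡ x ⟨
    1ℚ * x        ≡⟨ cong (_* x) (ℚ.*-inverseˡ a) ⟨
    1/ a * a * x  ≡⟨ ℚ.*-assoc (1/ a) a x ⟩
    1/ a * (a * x) ≡⟨ cong (1/ a *_) e ⟩
    1/ a * (a * y) ≡⟨ ℚ.*-assoc (1/ a) a y ⟨
    1/ a * a * y  ≡⟨ cong (_* y) (ℚ.*-inverseˡ a) ⟩
    1ℚ * y        ≡⟨ ℚ.*-identityˡ y ⟩
    y             ∎
    where
    open ≡-Reasoning
    instance _ = ℚ.≢-nonZero a≢0

  x*y≡0⇒y≡0 : ∀ {x y} → x ≢ 0ℚ → x * y ≡ 0ℚ → y ≡ 0ℚ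
  x*y≡0⇒y≡0 {x} x≢0 e = cancel-*ˡ x≢0 (trans e (sym (ℚ.*-zeroʳ x)))

  -- s scales a and t to integers ±α and τ without common factor.
  record Cleared (a t : ℚ) : Set where
    constructor cleared
    field
      s   : ℚ
      α τ : ℕ
      {{τ≢0}} : NonZero τ
      α⊥τ : Coprime α τ
      as² : (a * s) * (a * s) ≡ fromℕ (α ℕ.* α)
      ts² : (t * s) * (t * s) ≡ fromℕ (τ ℕ.* τ)

  -- Take s = δ / t with δ the denominator of a / t in lowest terms; then ts = δ, and as is the
  -- numerator.
  clear : ∀ a t → t ≢ 0ℚ → Cleared a t
  clear a t t≢0 = go (a * t⁻¹) refl
    where
    open ≡-Reasoning
    instance _ = ℚ.≢-nonZero t≢0
    t⁻¹ = 1/ t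
    go : ∀ x → x ≡ a * t⁻¹ → Cleared a t
    go x@(mkℚ i d i⊥d) x≡ = cleared (t⁻¹ * δ) ℤ.∣ i ∣ (suc d) (Coprimality.recompute i⊥d)
      (begin
        a * (t⁻¹ * δ) * (a * (t⁻¹ * δ)) ≡⟨ solve 3 (λ a t δ → a :* (t :* δ) :* (a :* (t :* δ)) := a :* t :* (a :* t) :* (δ :* δ)) refl a t⁻¹ δ ⟩
        a * t⁻¹ * (a * t⁻¹) * (δ * δ)   ≡⟨ cong (λ x → x * x * (δ * δ)) x≡ ⟨
        x * x * (δ * δ)                 ≡⟨ numerator-denominator x ⟩
        fromℕ (ℤ.∣ i ∣ ℕ.* ℤ.∣ i ∣)     ∎)
      (begin
        t * (t⁻¹ * δ) * (t * (t⁻¹ * δ)) ≡⟨ cong (λ x → x * x) (trans (sym (ℚ.*-assoc t t⁻¹ δ)) (trans (cong (_* δ) (ℚ.*-inverseʳ t)) (ℚ.*-identityˡ δ))) ⟩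
        δ * δ                           ≡⟨ fromℕ-* (suc d) (suc d) ⟨
        fromℕ (suc d ℕ.* suc d)         ∎)
      where
      δ = fromℕ (suc d)

  scale : ∀ s b n t m a → b * b + fromℕ n * (t * t) ≡ a * a + fromℕ m * (t * t) →
    b * s * (b * s) + fromℕ n * (t * s * (t * s)) ≡ a * s * (a * s) + fromℕ m * (t * s * (t * s))
  scale s b n t m a e = trans (f s b (fromℕ n) t) (trans (cong (s * s *_) e) (sym (f s a (fromℕ m) t)))
    where
    f : ∀ s b n t → b * s * (b * s) + n * (t * s * (t * s)) ≡ s * s * (b * b + n * (t * t))
    f = solve 4 (λ s b n t → b :* s :* (b :* s) :+ n :* (t :* s :* (t :* s)) := s :* s :* (b :* b :+ n :* (t :* t))) refl

  -- Having a multiple of t² on each side covers both roots: n = 0 yields the integer for b, and m =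
  -- 0 the one for c.
  cleared-root : ∀ {a t} ((cleared _ α τ _ _ _) : Cleared a t) → ∀ {b} n m →
    b * b + fromℕ n * (t * t) ≡ a * a + fromℕ m * (t * t) → ∃ λ β → β ℕ.* β ℕ.+ n ℕ.* (τ ℕ.* τ) ≡ α ℕ.* α ℕ.+ m ℕ.* (τ ℕ.* τ)
  cleared-root {a} {t} (cleared s α τ _ as² ts²) {b} n m e = integral-root (b * s) _ _ (begin
      b * s * (b * s) + fromℕ (n ℕ.* (τ ℕ.* τ))            ≡⟨ cong (λ z → b * s * (b * s) + z) (f n) ⟩
      b * s * (b * s) + fromℕ n * (t * s * (t * s))        ≡⟨ scale s b n t m a e ⟩
      a * s * (a * s) + fromℕ m * (t * s * (t * s))        ≡⟨ cong₂ _+_ as² (sym (f m)) ⟩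
      fromℕ (α ℕ.* α) + fromℕ (m ℕ.* (τ ℕ.* τ))            ≡⟨ fromℕ-+ (α ℕ.* α) _ ⟨
      fromℕ (α ℕ.* α ℕ.+ m ℕ.* (τ ℕ.* τ))                  ∎)
    where
    open ≡-Reasoning
    f : ∀ n → fromℕ (n ℕ.* (τ ℕ.* τ)) ≡ fromℕ n * (t * s * (t * s))
    f n = trans (fromℕ-* n _) (cong (fromℕ n *_) (sym ts²))

  no-rational-quadruple₁ : ∀ a b c t → t ≢ 0ℚ → b * b ≡ a * a + t * t → ¬ a * a ≡ c * c + fromℕ 3 * (t * t)
  no-rational-quadruple₁ a b c t t≢0 eq₁ eq₂ = no-quadruple₁ τ {{τ≢0}} (quadruple α β γ α⊥τ (sym (trans (sym (ℕ.+-identityʳ _)) (trans β²≡ (cong (α ℕ.* α ℕ.+_) (ℕ.*-identityˡ _)))))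
      (sym (trans (ℕ.+-comm (3 ℕ.* (τ ℕ.* τ)) _) (trans γ²≡ (ℕ.+-identityʳ _)))))
    where
    p = clear a t t≢0
    open Cleared p
    root-b = cleared-root p {b} 0 1 (trans (solve 2 (λ b t → b :* b :+ con 0ℚ :* (t :* t) := b :* b) refl b t) (trans eq₁ (cong (λ z → a * a + z) (sym (ℚ.*-identityˡ _)))))
    root-c = cleared-root p {c} 3 0 (trans (sym eq₂) (solve 2 (λ a t → a :* a := a :* a :+ con 0ℚ :* (t :* t)) refl a t))
    β = proj₁ root-b
    β²≡ = proj₂ root-b
    γ = proj₁ root-c
    γ²≡ = proj₂ root-c

  no-rational-quadruple₂ : ∀ a b c t → t ≢ 0ℚ → b * b ≡ a * a + fromℕ 3 * (t * t) → ¬ a * a ≡ c * c + fromℕ 9 * (t * t)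
  no-rational-quadruple₂ a b c t t≢0 eq₁ eq₂ = no-quadruple₂ τ {{τ≢0}} (quadruple α β γ α⊥τ (sym (trans (sym (ℕ.+-identityʳ _)) β²≡))
      (sym (trans (ℕ.+-comm (9 ℕ.* (τ ℕ.* τ)) _) (trans γ²≡ (ℕ.+-identityʳ _)))))
    where
    p = clear a t t≢0
    open Cleared p
    root-b = cleared-root p {b} 0 3 (trans (solve 2 (λ b t → b :* b :+ con 0ℚ :* (t :* t) := b :* b) refl b t) eq₁)
    root-c = cleared-root p {c} 9 0 (trans (sym eq₂) (solve 2 (λ a t → a :* a := a :* a :+ con 0ℚ :* (t :* t)) refl a t))
    β = proj₁ root-b
    β²≡ = proj₂ root-b
    γ = proj₁ root-c
    γ²≡ = proj₂ root-c

-- Triangles for n = 1 over ℚ(√3).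

module Quadratic where

  open import Algebra.Bundles using (CommutativeRing)
  import Algebra.Solver.Ring.AlmostCommutativeRing as ACR
  import Algebra.Solver.Ring.Simple as RingSolver
  open import Algebra.Structures using (IsCommutativeRing)
  open import Data.Empty using (⊥; ⊥-elim)
  open import Data.Integer.Base using (+_; +<+)
  open import Data.Nat.Base using (ℕ)
  open import Data.Product.Base using (_×_; _,_)
  open import Data.Rational.Base as ℚ using (ℚ; 0ℚ; 1ℚ; *<*)
  import Data.Rational.Properties as ℚ
  import Data.Rational.Solver as ℚS
  open import Data.Sum.Base using (_⊎_; inj₁; inj₂; [_,_]′)
  open import Function.Base using (case_of_)
  open import Function.Bundles using (Injection)
  open import Level using (0ℓ)
  open import Relation.Binary.Definitions using (DecidableEquality)
  open import Relation.Binary.PropositionalEquality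
  open import Relation.Nullary using (¬_; Dec; yes; no)
  open import Relation.Nullary.Decidable using (map′; _×-dec_; decidable-stable)
  open import Defs
  open Descent using (3-nonsquare)
  open Rationals
  open ℚ[√_]
  module F = ℚS.+-*-Solver

  module _ (d : ℕ) where
    private
      δ : ℚ
      δ = fromℕ d

    -‿_ : ℚ[√ d ] → ℚ[√ d ]
    -‿ ⟨ a , b ⟩ = ⟨ ℚ.- a , ℚ.- b ⟩

    isCommutativeRing : IsCommutativeRing {A = ℚ[√ d ]} _≡_ _+_ _*_ -‿_ (fromℚ 0ℚ) (fromℚ 1ℚ)
    isCommutativeRing = record
      { isRing = record
        { +-isAbelianGroup = record
          { isGroup = record
            { isMonoid = record
              { isSemigroup = record
                { isMagma = record { isEquivalence = isEquivalence ; ∙-cong = cong₂ _+_ }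
                ; assoc = λ (⟨ a , b ⟩) (⟨ a′ , b′ ⟩) (⟨ a″ , b″ ⟩) → cong₂ ⟨_,_⟩ (ℚ.+-assoc a a′ a″) (ℚ.+-assoc b b′ b″)
                }
              ; identity = (λ (⟨ a , b ⟩) → cong₂ ⟨_,_⟩ (ℚ.+-identityˡ a) (ℚ.+-identityˡ b))
                         , (λ (⟨ a , b ⟩) → cong₂ ⟨_,_⟩ (ℚ.+-identityʳ a) (ℚ.+-identityʳ b))
              }
            ; inverse = (λ (⟨ a , b ⟩) → cong₂ ⟨_,_⟩ (ℚ.+-inverseˡ a) (ℚ.+-inverseˡ b))
                      , (λ (⟨ a , b ⟩) → cong₂ ⟨_,_⟩ (ℚ.+-inverseʳ a) (ℚ.+-inverseʳ b))
            ; ⁻¹-cong = cong -‿_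
            }
          ; comm = λ (⟨ a , b ⟩) (⟨ a′ , b′ ⟩) → cong₂ ⟨_,_⟩ (ℚ.+-comm a a′) (ℚ.+-comm b b′)
          }
        ; *-cong = cong₂ _*_
        ; *-assoc = λ (⟨ a , b ⟩) (⟨ a′ , b′ ⟩) (⟨ a″ , b″ ⟩) → cong₂ ⟨_,_⟩
            (F.solve 7 (λ δ a b a′ b′ a″ b″ →
              (a F.:* a′ F.:+ δ F.:* (b F.:* b′)) F.:* a″ F.:+ δ F.:* ((a F.:* b′ F.:+ b F.:* a′) F.:* b″)
              F.:= a F.:* (a′ F.:* a″ F.:+ δ F.:* (b′ F.:* b″)) F.:+ δ F.:* (b F.:* (a′ F.:* b″ F.:+ b′ F.:* a″))) refl δ a b a′ b′ a″ b″)
            (F.solve 7 (λ δ a b a′ b′ a″ b″ →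
              (a F.:* a′ F.:+ δ F.:* (b F.:* b′)) F.:* b″ F.:+ (a F.:* b′ F.:+ b F.:* a′) F.:* a″
              F.:= a F.:* (a′ F.:* b″ F.:+ b′ F.:* a″) F.:+ b F.:* (a′ F.:* a″ F.:+ δ F.:* (b′ F.:* b″))) refl δ a b a′ b′ a″ b″)
        ; *-identity =
            (λ (⟨ a , b ⟩) → cong₂ ⟨_,_⟩
              (F.solve 3 (λ δ a b → F.con 1ℚ F.:* a F.:+ δ F.:* (F.con 0ℚ F.:* b) F.:= a) refl δ a b)
              (F.solve 2 (λ a b → F.con 1ℚ F.:* b F.:+ F.con 0ℚ F.:* a F.:= b) refl a b))
          , (λ (⟨ a , b ⟩) → cong₂ ⟨_,_⟩
              (F.solve 3 (λ δ a b → a F.:* F.con 1ℚ F.:+ δ F.:* (b F.:* F.con 0ℚ) F.:= a) refl δ a b)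
              (F.solve 2 (λ a b → a F.:* F.con 0ℚ F.:+ b F.:* F.con 1ℚ F.:= b) refl a b))
        ; distrib =
            (λ (⟨ a , b ⟩) (⟨ a′ , b′ ⟩) (⟨ a″ , b″ ⟩) → cong₂ ⟨_,_⟩
              (F.solve 7 (λ δ a b a′ b′ a″ b″ →
                a F.:* (a′ F.:+ a″) F.:+ δ F.:* (b F.:* (b′ F.:+ b″))
                F.:= a F.:* a′ F.:+ δ F.:* (b F.:* b′) F.:+ (a F.:* a″ F.:+ δ F.:* (b F.:* b″))) refl δ a b a′ b′ a″ b″)
              (F.solve 6 (λ a b a′ b′ a″ b″ →
                a F.:* (b′ F.:+ b″) F.:+ b F.:* (a′ F.:+ a″)
                F.:= a F.:* b′ F.:+ b F.:* a′ F.:+ (a F.:* b″ F.:+ b F.:* a″)) refl a b a′ b′ a″ b″))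
          , (λ (⟨ a , b ⟩) (⟨ a′ , b′ ⟩) (⟨ a″ , b″ ⟩) → cong₂ ⟨_,_⟩
              (F.solve 7 (λ δ a b a′ b′ a″ b″ →
                (a′ F.:+ a″) F.:* a F.:+ δ F.:* ((b′ F.:+ b″) F.:* b)
                F.:= a′ F.:* a F.:+ δ F.:* (b′ F.:* b) F.:+ (a″ F.:* a F.:+ δ F.:* (b″ F.:* b))) refl δ a b a′ b′ a″ b″)
              (F.solve 6 (λ a b a′ b′ a″ b″ →
                (a′ F.:+ a″) F.:* b F.:+ (b′ F.:+ b″) F.:* a
                F.:= a′ F.:* b F.:+ b′ F.:* a F.:+ (a″ F.:* b F.:+ b″ F.:* a)) refl a b a′ b′ a″ b″))
        }
      ; *-comm = λ (⟨ a , b ⟩) (⟨ a′ , b′ ⟩) → cong₂ ⟨_,_⟩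
          (F.solve 5 (λ δ a b a′ b′ → a F.:* a′ F.:+ δ F.:* (b F.:* b′) F.:= a′ F.:* a F.:+ δ F.:* (b′ F.:* b)) refl δ a b a′ b′)
          (F.solve 4 (λ a b a′ b′ → a F.:* b′ F.:+ b F.:* a′ F.:= a′ F.:* b F.:+ b′ F.:* a) refl a b a′ b′)
      }

    commutativeRing : CommutativeRing 0ℓ 0ℓ
    commutativeRing = record { isCommutativeRing = isCommutativeRing }

    _≟_ : DecidableEquality ℚ[√ d ]
    ⟨ a , b ⟩ ≟ ⟨ a′ , b′ ⟩ = map′ (λ (p , q) → cong₂ ⟨_,_⟩ p q) (λ { refl → refl , refl }) ((a ℚ.≟ a′) ×-dec (b ℚ.≟ b′))

  module Solver₃ = RingSolver (ACR.fromCommutativeRing (commutativeRing 3)) (_≟_ 3)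
  open Solver₃
  ℚ√3 = ℚ[√ 3 ]

  -- With x = w² and y = wpm the two identities express that the coordinates
  -- x , x + e and x - 3e of the sum of (x , y) and (x′ , y′) are squares.
  cross₁ : ∀ (w p m w′ p′ m′ e : ℚ√3) → p * p ≡ w * w + e → p′ * p′ ≡ w′ * w′ + e →
    m * m ≡ w * w - (e + e + e) → m′ * m′ ≡ w′ * w′ - (e + e + e) →
    (w * m * p′ - w′ * m′ * p) * (w * m * p′ - w′ * m′ * p)
    ≡ (p * m * w′ - p′ * m′ * w) * (p * m * w′ - p′ * m′ * w) + e * ((w * w - w′ * w′) * (w * w - w′ * w′))
  cross₁ w p m w′ p′ m′ e hp hp′ hm hm′ = trans
    (solve 6 (λ w p m w′ p′ m′ →
        (w :* m :* p′ :- w′ :* m′ :* p) :* (w :* m :* p′ :- w′ :* m′ :* p)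
        := (w :* w :* (m :* m) :* (p′ :* p′) :+ w′ :* w′ :* (m′ :* m′) :* (p :* p))
          :- (w :* m :* p :* (w′ :* m′ :* p′) :+ w :* m :* p :* (w′ :* m′ :* p′))) refl w p m w′ p′ m′)
    (trans (substituted (w * w) (w′ * w′) (w * m * p * (w′ * m′ * p′)) hp hp′ hm hm′)
    (sym (solve 7 (λ w p m w′ p′ m′ e →
        (p :* m :* w′ :- p′ :* m′ :* w) :* (p :* m :* w′ :- p′ :* m′ :* w) :+ e :* ((w :* w :- w′ :* w′) :* (w :* w :- w′ :* w′))
        := ((p :* p :* (m :* m) :* (w′ :* w′) :+ p′ :* p′ :* (m′ :* m′) :* (w :* w))
          :- (w :* m :* p :* (w′ :* m′ :* p′) :+ w :* m :* p :* (w′ :* m′ :* p′)))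
          :+ e :* ((w :* w :- w′ :* w′) :* (w :* w :- w′ :* w′))) refl w p m w′ p′ m′ e)))
    where
    -- After expansion only squares and the mixed product X = wmp · w′p′m′ occur; naming the squares
    -- by variables lets the hypotheses be eliminated by `refl`.
    substituted : ∀ W W′ X {P P′ M M′} → P ≡ W + e → P′ ≡ W′ + e → M ≡ W - (e + e + e) → M′ ≡ W′ - (e + e + e) →
      (W * M * P′ + W′ * M′ * P) - (X + X) ≡ ((P * M * W′ + P′ * M′ * W) - (X + X)) + e * ((W - W′) * (W - W′))
    substituted W W′ X refl refl refl refl = solve 4 (λ W W′ X e →
      let P = W :+ e ; P′ = W′ :+ e ; M = W :- (e :+ e :+ e) ; M′ = W′ :- (e :+ e :+ e) in
      (W :* M :* P′ :+ W′ :* M′ :* P) :- (X :+ X) := ((P :* M :* W′ :+ P′ :* M′ :* W) :- (X :+ X)) :+ e :* ((W :- W′) :* (W :- W′)))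
      refl W W′ X e

  cross₂ : ∀ (w p m w′ p′ m′ e : ℚ√3) → p * p ≡ w * w + e → p′ * p′ ≡ w′ * w′ + e →
    m * m ≡ w * w - (e + e + e) → m′ * m′ ≡ w′ * w′ - (e + e + e) →
    (p * m * w′ - p′ * m′ * w) * (p * m * w′ - p′ * m′ * w)
    ≡ (w * p * m′ - w′ * p′ * m) * (w * p * m′ - w′ * p′ * m) + (e + e + e) * ((w * w - w′ * w′) * (w * w - w′ * w′))
  cross₂ w p m w′ p′ m′ e hp hp′ hm hm′ = trans
    (solve 6 (λ w p m w′ p′ m′ →
        (p :* m :* w′ :- p′ :* m′ :* w) :* (p :* m :* w′ :- p′ :* m′ :* w)
        := (p :* p :* (m :* m) :* (w′ :* w′) :+ p′ :* p′ :* (m′ :* m′) :* (w :* w))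
          :- (w :* m :* p :* (w′ :* m′ :* p′) :+ w :* m :* p :* (w′ :* m′ :* p′))) refl w p m w′ p′ m′)
    (trans (substituted (w * w) (w′ * w′) (w * m * p * (w′ * m′ * p′)) hp hp′ hm hm′)
    (sym (solve 7 (λ w p m w′ p′ m′ e →
        (w :* p :* m′ :- w′ :* p′ :* m) :* (w :* p :* m′ :- w′ :* p′ :* m) :+ (e :+ e :+ e) :* ((w :* w :- w′ :* w′) :* (w :* w :- w′ :* w′))
        := ((w :* w :* (p :* p) :* (m′ :* m′) :+ w′ :* w′ :* (p′ :* p′) :* (m :* m))
          :- (w :* m :* p :* (w′ :* m′ :* p′) :+ w :* m :* p :* (w′ :* m′ :* p′)))
          :+ (e :+ e :+ e) :* ((w :* w :- w′ :* w′) :* (w :* w :- w′ :* w′))) refl w p m w′ p′ m′ e)))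
    where
    substituted : ∀ W W′ X {P P′ M M′} → P ≡ W + e → P′ ≡ W′ + e → M ≡ W - (e + e + e) → M′ ≡ W′ - (e + e + e) →
      (P * M * W′ + P′ * M′ * W) - (X + X) ≡ ((W * P * M′ + W′ * P′ * M) - (X + X)) + (e + e + e) * ((W - W′) * (W - W′))
    substituted W W′ X refl refl refl refl = solve 4 (λ W W′ X e →
      let P = W :+ e ; P′ = W′ :+ e ; M = W :- (e :+ e :+ e) ; M′ = W′ :- (e :+ e :+ e) in
      (P :* M :* W′ :+ P′ :* M′ :* W) :- (X :+ X) := ((W :* P :* M′ :+ W′ :* P′ :* M) :- (X :+ X)) :+ (e :+ e :+ e) :* ((W :- W′) :* (W :- W′)))
      refl W W′ X e

  -- Conjugation, norm and the passage to rational points.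

  conj : ℚ√3 → ℚ√3
  conj ⟨ a , b ⟩ = ⟨ a , ℚ.- b ⟩

  conj-* : ∀ x y → conj (x * y) ≡ conj x * conj y
  conj-* ⟨ a , b ⟩ ⟨ a′ , b′ ⟩ = cong₂ ⟨_,_⟩
    (F.solve 5 (λ δ a b a′ b′ → a F.:* a′ F.:+ δ F.:* (b F.:* b′) F.:= a F.:* a′ F.:+ δ F.:* (F.:- b F.:* F.:- b′)) refl (fromℕ 3) a b a′ b′)
    (F.solve 4 (λ a b a′ b′ → F.:- (a F.:* b′ F.:+ b F.:* a′) F.:= a F.:* F.:- b′ F.:+ F.:- b F.:* a′) refl a b a′ b′)

  conj-involutive : ∀ x → conj (conj x) ≡ x
  conj-involutive ⟨ a , b ⟩ = cong ⟨ a ,_⟩ (F.solve 1 (λ b → F.:- (F.:- b) F.:= b) refl b)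

  conj-+ℚ : ∀ x q → conj (x + fromℚ q) ≡ conj x + fromℚ q
  conj-+ℚ ⟨ a , b ⟩ q = cong ⟨ a ℚ.+ q ,_⟩ (F.solve 1 (λ b → F.:- (b F.:+ F.con 0ℚ) F.:= F.:- b F.:+ F.con 0ℚ) refl b)

  x-conj : ∀ x → x - conj x ≡ (irr x ℚ.+ irr x) √
  x-conj ⟨ a , b ⟩ = cong₂ ⟨_,_⟩ (ℚ.+-inverseʳ a) (F.solve 1 (λ b → b F.:- (F.:- b) F.:= b F.:+ b) refl b)

  -- Every term carries the factor 3 = √3², and cancelling it leaves a relation over ℚ.
  √-relation : ∀ {a b d e : ℚ} → (b √ * b √) ≡ (a √ * a √) + fromℚ {3} e * (d √ * d √) → b ℚ.* b ≡ a ℚ.* a ℚ.+ e ℚ.* (d ℚ.* d)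
  √-relation {a} {b} {d} {e} h = cancel-*ˡ {fromℕ 3} (λ ()) (trans
    (F.solve 1 (λ b → F.con (fromℕ 3) F.:* (b F.:* b) F.:= F.con 0ℚ F.:* F.con 0ℚ F.:+ F.con (fromℕ 3) F.:* (b F.:* b)) refl b)
    (trans (cong rat h)
    (F.solve 3 (λ a d e → F.con 0ℚ F.:* F.con 0ℚ F.:+ F.con (fromℕ 3) F.:* (a F.:* a) F.:+
       (e F.:* (F.con 0ℚ F.:* F.con 0ℚ F.:+ F.con (fromℕ 3) F.:* (d F.:* d)) F.:+ F.con (fromℕ 3) F.:* (F.con 0ℚ F.:* (F.con 0ℚ F.:* d F.:+ d F.:* F.con 0ℚ)))
       F.:= F.con (fromℕ 3) F.:* (a F.:* a F.:+ e F.:* (d F.:* d))) refl a d e)))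

  √3-irrational : ∀ {a b} → a ℚ.* a ≡ fromℕ 3 ℚ.* (b ℚ.* b) → b ≡ 0ℚ
  √3-irrational {a} {b} e = decidable-stable (b ℚ.≟ 0ℚ) λ b≢0 → refute (ℚ.1/_ b {{ℚ.≢-nonZero b≢0}}) (ℚ.*-inverseʳ b {{ℚ.≢-nonZero b≢0}})
    where
    refute : ∀ r → b ℚ.* r ≡ 1ℚ → ⊥
    refute r br≡1 = let m , m²≡3 = integral-root (a ℚ.* r) 0 3 ratio²≡3 in 3-nonsquare m m²≡3
      where
      ratio²≡3 : a ℚ.* r ℚ.* (a ℚ.* r) ℚ.+ 0ℚ ≡ fromℕ 3
      ratio²≡3 =
        trans (F.solve 2 (λ a r → a F.:* r F.:* (a F.:* r) F.:+ F.con 0ℚ F.:= a F.:* a F.:* (r F.:* r)) refl a r)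
        (trans (cong (ℚ._* (r ℚ.* r)) e)
        (trans (F.solve 2 (λ b r → F.con (fromℕ 3) F.:* (b F.:* b) F.:* (r F.:* r) F.:= F.con (fromℕ 3) F.:* (b F.:* r F.:* (b F.:* r))) refl b r)
        (cong (λ z → fromℕ 3 ℚ.* (z ℚ.* z)) br≡1)))

  norm : ℚ√3 → ℚ
  norm ⟨ a , b ⟩ = a ℚ.* a ℚ.- fromℕ 3 ℚ.* (b ℚ.* b)

  ℚ-x-y≡0 : ∀ {x y} → x ℚ.- y ≡ 0ℚ → x ≡ y
  ℚ-x-y≡0 {x} {y} e = trans (F.solve 2 (λ x y → x F.:= x F.:- y F.:+ y) refl x y) (trans (cong (ℚ._+ y) e) (ℚ.+-identityˡ y))

  norm≡0⇒≡0 : ∀ x → norm x ≡ 0ℚ → x ≡ fromℚ 0ℚ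
  norm≡0⇒≡0 ⟨ a , b ⟩ e = cong₂ ⟨_,_⟩ a≡0 b≡0
    where
    a²≡3b² : a ℚ.* a ≡ fromℕ 3 ℚ.* (b ℚ.* b)
    a²≡3b² = ℚ-x-y≡0 e
    b≡0 : b ≡ 0ℚ
    b≡0 = √3-irrational {a} {b} a²≡3b²
    a≡0 : a ≡ 0ℚ
    a≡0 = decidable-stable (a ℚ.≟ 0ℚ) λ a≢0 → a≢0 (x*y≡0⇒y≡0 a≢0 (trans a²≡3b² (cong (λ b → fromℕ 3 ℚ.* (b ℚ.* b)) b≡0)))

  norm*rat : ∀ x y → norm x ℚ.* rat y ≡ rat (conj x * (x * y))
  norm*rat ⟨ a , b ⟩ ⟨ a′ , b′ ⟩ = F.solve 4 (λ a b a′ b′ → (a F.:* a F.:- three F.:* (b F.:* b)) F.:* a′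
      F.:= a F.:* (a F.:* a′ F.:+ three F.:* (b F.:* b′)) F.:+ three F.:* (F.:- b F.:* (a F.:* b′ F.:+ b F.:* a′))) refl a b a′ b′
    where three = F.con (fromℕ 3)

  norm*irr : ∀ x y → norm x ℚ.* irr y ≡ irr (conj x * (x * y))
  norm*irr ⟨ a , b ⟩ ⟨ a′ , b′ ⟩ = F.solve 4 (λ a b a′ b′ → (a F.:* a F.:- three F.:* (b F.:* b)) F.:* b′
      F.:= a F.:* (a F.:* b′ F.:+ b F.:* a′) F.:+ F.:- b F.:* (a F.:* a′ F.:+ three F.:* (b F.:* b′))) refl a b a′ b′
    where three = F.con (fromℕ 3)

  *-zeroʳ : ∀ x → x * fromℚ 0ℚ ≡ fromℚ 0ℚ
  *-zeroʳ x = solve 1 (λ x → x :* con (fromℚ 0ℚ) := con (fromℚ 0ℚ)) refl x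

  -- Multiplying by conj x turns xy = 0 into N(x) y = 0 over ℚ, and N(x) vanishes only at x = 0
  -- because √3 is irrational.
  x*y≡0 : ∀ x y → x * y ≡ fromℚ 0ℚ → x ≡ fromℚ 0ℚ ⊎ y ≡ fromℚ 0ℚ
  x*y≡0 x y e = go (norm x ℚ.≟ 0ℚ)
    where
    zero′ : conj x * (x * y) ≡ fromℚ 0ℚ
    zero′ = trans (cong (conj x *_) e) (*-zeroʳ (conj x))
    go : Dec (norm x ≡ 0ℚ) → x ≡ fromℚ 0ℚ ⊎ y ≡ fromℚ 0ℚ
    go (yes n≡0) = inj₁ (norm≡0⇒≡0 x n≡0)
    go (no n≢0)  = inj₂ (cong₂ ⟨_,_⟩ (x*y≡0⇒y≡0 n≢0 (trans (norm*rat x y) (cong rat zero′)))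
                                     (x*y≡0⇒y≡0 n≢0 (trans (norm*irr x y) (cong irr zero′))))

  square-root-cases : ∀ x y → x * x ≡ y * y → x ≡ y ⊎ x ≡ fromℚ 0ℚ - y
  square-root-cases x y e = go (x*y≡0 (x - y) (x + y)
    (trans (solve 2 (λ x y → (x :- y) :* (x :+ y) := x :* x :- y :* y) refl x y)
    (trans (cong (_- y * y) e) (solve 1 (λ y → y :* y :- y :* y := con (fromℚ 0ℚ)) refl y))))
    where
    go : x - y ≡ fromℚ 0ℚ ⊎ x + y ≡ fromℚ 0ℚ → x ≡ y ⊎ x ≡ fromℚ 0ℚ - y
    go (inj₁ p) = inj₁ (trans (solve 2 (λ x y → x := (x :- y) :+ y) refl x y) (trans (cong (_+ y) p) (solve 1 (λ y → con (fromℚ 0ℚ) :+ y := y) refl y)))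
    go (inj₂ p) = inj₂ (trans (solve 2 (λ x y → x := (x :+ y) :- y) refl x y) (cong (_- y) p))

  0≤x² : ∀ x → 0ℚ ℚ.≤ x ℚ.* x
  0≤x² x with ℚ.≤-total 0ℚ x
  ... | inj₁ 0≤x = ℚ.nonNegative⁻¹ (x ℚ.* x) {{ℚ.nonNeg*nonNeg⇒nonNeg x {{ℚ.nonNegative 0≤x}} x {{ℚ.nonNegative 0≤x}}}}
  ... | inj₂ x≤0 = ℚ.nonNegative⁻¹ (x ℚ.* x) {{ℚ.nonPos*nonPos⇒nonPos x {{ℚ.nonPositive x≤0}} x {{ℚ.nonPositive x≤0}}}}

  -- The rational coordinate of (a + b√3)² is a² + 3b².
  rational-square-nonneg : ∀ (z : ℚ√3) {q} → z * z ≡ fromℚ q → 0ℚ ℚ.≤ q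
  rational-square-nonneg ⟨ a , b ⟩ e = subst (0ℚ ℚ.≤_) (cong rat e)
    (ℚ.+-mono-≤ (0≤x² a) (ℚ.*-monoˡ-≤-nonNeg (fromℕ 3) (0≤x² b)))

  -- (a∞ / t)² is the x-coordinate of twice the point (x , y) on
  -- y² = x (x + e) (x - 3e), where t² = 4 e y².
  module _ (x e : ℚ) where
    four× : ℚ → ℚ
    four× x = (x ℚ.+ x) ℚ.+ (x ℚ.+ x)

    cubic a∞ b∞ c∞ : ℚ
    cubic = x ℚ.* (x ℚ.+ e) ℚ.* (x ℚ.- (e ℚ.+ e ℚ.+ e))
    a∞ = x ℚ.* x ℚ.+ (e ℚ.* e ℚ.+ e ℚ.* e ℚ.+ e ℚ.* e)
    b∞ = (x ℚ.+ e) ℚ.* (x ℚ.+ e) ℚ.- four× (e ℚ.* e)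
    c∞ = (x ℚ.- (e ℚ.+ e ℚ.+ e)) ℚ.* (x ℚ.- (e ℚ.+ e ℚ.+ e)) ℚ.- (four× (e ℚ.* e) ℚ.+ four× (e ℚ.* e) ℚ.+ four× (e ℚ.* e))

    private
      :4× : ∀ {n} → F.Polynomial n → F.Polynomial n
      :4× x = (x F.:+ x) F.:+ (x F.:+ x)

    duplication₁ : b∞ ℚ.* b∞ ≡ a∞ ℚ.* a∞ ℚ.+ four× e ℚ.* cubic
    duplication₁ = F.solve 2 (λ x e →
      let a = x F.:* x F.:+ (e F.:* e F.:+ e F.:* e F.:+ e F.:* e)
          b = (x F.:+ e) F.:* (x F.:+ e) F.:- :4× (e F.:* e)
          y = x F.:* (x F.:+ e) F.:* (x F.:- (e F.:+ e F.:+ e))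
      in b F.:* b F.:= a F.:* a F.:+ :4× e F.:* y) refl x e

    duplication₂ : a∞ ℚ.* a∞ ≡ c∞ ℚ.* c∞ ℚ.+ fromℕ 3 ℚ.* (four× e ℚ.* cubic)
    duplication₂ = F.solve 2 (λ x e →
      let a = x F.:* x F.:+ (e F.:* e F.:+ e F.:* e F.:+ e F.:* e)
          c = (x F.:- (e F.:+ e F.:+ e)) F.:* (x F.:- (e F.:+ e F.:+ e)) F.:- (:4× (e F.:* e) F.:+ :4× (e F.:* e) F.:+ :4× (e F.:* e))
          y = x F.:* (x F.:+ e) F.:* (x F.:- (e F.:+ e F.:+ e))
      in a F.:* a F.:= c F.:* c F.:+ F.con (fromℕ 3) F.:* (:4× e F.:* y)) refl x e

  4y≢0 : ∀ {y} → y ≢ 0ℚ → fromℕ 4 ℚ.* y ≢ 0ℚ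
  4y≢0 y≢0 4y≡0 = y≢0 (x*y≡0⇒y≡0 {fromℕ 4} (λ ()) 4y≡0)

  -- Doubling a rational point with y ≠ 0 solves the first system: for e = 4 one has 4ey² = (4y)²,
  -- so t = 4y.
  rational-cubic₁ : ∀ x y → y ≢ 0ℚ → cubic x (fromℕ 4) ≢ y ℚ.* y
  rational-cubic₁ x y y≢0 e = no-rational-quadruple₁ (a∞ x (fromℕ 4)) (b∞ x (fromℕ 4)) (c∞ x (fromℕ 4)) (fromℕ 4 ℚ.* y) (4y≢0 y≢0)
    (trans (duplication₁ x (fromℕ 4)) (cong (λ z → a∞ x (fromℕ 4) ℚ.* a∞ x (fromℕ 4) ℚ.+ z) eq))
    (trans (duplication₂ x (fromℕ 4)) (cong (λ z → c∞ x (fromℕ 4) ℚ.* c∞ x (fromℕ 4) ℚ.+ fromℕ 3 ℚ.* z) eq))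
    where
    eq : fromℕ 16 ℚ.* cubic x (fromℕ 4) ≡ fromℕ 4 ℚ.* y ℚ.* (fromℕ 4 ℚ.* y)
    eq = trans (cong (fromℕ 16 ℚ.*_) e) (F.solve 1 (λ y → F.con (fromℕ 16) F.:* (y F.:* y) F.:= F.con (fromℕ 4) F.:* y F.:* (F.con (fromℕ 4) F.:* y)) refl y)

  -- On the twist by 3 the same duplication identities have 3(4y)² in place of (4y)², which is the
  -- second system.
  rational-cubic₂ : ∀ x y → y ≢ 0ℚ → cubic x (fromℕ 4) ≢ fromℕ 3 ℚ.* (y ℚ.* y)
  rational-cubic₂ x y y≢0 e = no-rational-quadruple₂ (a∞ x (fromℕ 4)) (b∞ x (fromℕ 4)) (c∞ x (fromℕ 4)) (fromℕ 4 ℚ.* y) (4y≢0 y≢0)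
    (trans (duplication₁ x (fromℕ 4)) (cong (λ z → a∞ x (fromℕ 4) ℚ.* a∞ x (fromℕ 4) ℚ.+ z) eq))
    (trans (duplication₂ x (fromℕ 4)) (cong (λ z → c∞ x (fromℕ 4) ℚ.* c∞ x (fromℕ 4) ℚ.+ z) (trans (cong (fromℕ 3 ℚ.*_) eq)
      (F.solve 1 (λ t → F.con (fromℕ 3) F.:* (F.con (fromℕ 3) F.:* t) F.:= F.con (fromℕ 9) F.:* t) refl (fromℕ 4 ℚ.* y ℚ.* (fromℕ 4 ℚ.* y))))))
    where
    eq : fromℕ 16 ℚ.* cubic x (fromℕ 4) ≡ fromℕ 3 ℚ.* (fromℕ 4 ℚ.* y ℚ.* (fromℕ 4 ℚ.* y))
    eq = trans (cong (fromℕ 16 ℚ.*_) e) (F.solve 1 (λ y → F.con (fromℕ 16) F.:* (F.con (fromℕ 3) F.:* (y F.:* y)) F.:= F.con (fromℕ 3) F.:* (F.con (fromℕ 4) F.:* y F.:* (F.con (fromℕ 4) F.:* y))) refl y)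

  fromℚ-* : ∀ {d} x y → fromℚ {d} x * fromℚ y ≡ fromℚ (x ℚ.* y)
  fromℚ-* {d} x y = cong₂ ⟨_,_⟩
    (F.solve 3 (λ δ x y → x F.:* y F.:+ δ F.:* (F.con 0ℚ F.:* F.con 0ℚ) F.:= x F.:* y) refl (fromℕ d) x y)
    (F.solve 2 (λ x y → x F.:* F.con 0ℚ F.:+ F.con 0ℚ F.:* y F.:= F.con 0ℚ) refl x y)

  -- The two products are conjugate, so their difference is a rational multiple of √3, as
  -- `√-relation` requires.
  difference : ∀ x y s → x * y * conj s - conj x * conj y * s ≡ (irr (x * y * conj s) ℚ.+ irr (x * y * conj s)) √
  difference x y s = trans (cong (x * y * conj s -_) (sym conjugated)) (x-conj (x * y * conj s))
    where
    conjugated : conj (x * y * conj s) ≡ conj x * conj y * s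
    conjugated = trans (conj-* (x * y) (conj s)) (cong₂ _*_ (conj-* x y) (conj-involutive s))

  conj-square : ∀ x y q → x * x ≡ y * y + fromℚ q → conj x * conj x ≡ conj y * conj y + fromℚ q
  conj-square x y q e = trans (sym (conj-* x x)) (trans (cong conj e) (trans (conj-+ℚ (y * y) q) (cong (_+ fromℚ q) (conj-* y y))))

  module _ (w p m : ℚ√3) (hp : p * p ≡ w * w + fromℚ (fromℕ 4)) (hm : m * m ≡ w * w - fromℚ (fromℕ 12)) where

    -- Otherwise adding the conjugate of the point over w² would yield a
    -- rational quadruple.
    rational-w² : irr (w * w) ≡ 0ℚ
    rational-w² = decidable-stable (irr (w * w) ℚ.≟ 0ℚ) λ D≢0 →
      no-rational-quadruple₁ a b c t (λ t≡0 → D≢0 (x*y≡0⇒y≡0 {fromℕ 4} (λ ()) (trans (F.solve 1 (λ D → F.con (fromℕ 4) F.:* D F.:= (D F.:+ D) F.:+ (D F.:+ D)) refl D) t≡0)))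
        (trans (√-relation {a = a} {b} {d} {fromℕ 4} rel₁) (cong (λ z → a ℚ.* a ℚ.+ z) (F.solve 1 (λ d → F.con (fromℕ 4) F.:* (d F.:* d) F.:= (d F.:+ d) F.:* (d F.:+ d)) refl d)))
        (trans (√-relation {a = c} {a} {d} {fromℕ 12} rel₂) (cong (λ z → c ℚ.* c ℚ.+ z) (F.solve 1 (λ d → F.con (fromℕ 12) F.:* (d F.:* d) F.:= F.con (fromℕ 3) F.:* ((d F.:+ d) F.:* (d F.:+ d))) refl d)))
      where
      w′ = conj w
      p′ = conj p
      m′ = conj m
      D = irr (w * w)
      a = irr (p * m * w′) ℚ.+ irr (p * m * w′)
      b = irr (w * m * p′) ℚ.+ irr (w * m * p′)
      c = irr (w * p * m′) ℚ.+ irr (w * p * m′)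
      d = D ℚ.+ D
      -- The relations contain 4d² and 12d², that is t² and 3t² for t = 2d.
      t = d ℚ.+ d
      hp′ : p′ * p′ ≡ w′ * w′ + fromℚ (fromℕ 4)
      hp′ = conj-square p w (fromℕ 4) hp
      hm′ : m′ * m′ ≡ w′ * w′ - fromℚ (fromℕ 12)
      -- Subtracting 12 computes to adding -12, so `conj-square` also covers this sign.
      hm′ = conj-square m w (ℚ.- fromℕ 12) hm
      w²-w′² : w * w - w′ * w′ ≡ d √
      w²-w′² = trans (cong (w * w -_) (sym (conj-* w w))) (x-conj (w * w))
      rel₁ : b √ * b √ ≡ a √ * a √ + fromℚ (fromℕ 4) * (d √ * d √)
      rel₁ = trans (cong (λ z → z * z) (sym (difference w m p)))
        (trans (cross₁ w p m w′ p′ m′ (fromℚ (fromℕ 4)) hp hp′ hm hm′)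
               (cong₂ (λ y z → y * y + fromℚ (fromℕ 4) * (z * z)) (difference p m w) w²-w′²))
      rel₂ : a √ * a √ ≡ c √ * c √ + fromℚ (fromℕ 12) * (d √ * d √)
      rel₂ = trans (cong (λ z → z * z) (sym (difference p m w)))
        (trans (cross₂ w p m w′ p′ m′ (fromℚ (fromℕ 4)) hp hp′ hm hm′)
               (cong₂ (λ y z → y * y + fromℚ (fromℕ 12) * (z * z)) (difference w p m) w²-w′²))

    private
      x = rat (w * w)
      w²≡x : w * w ≡ fromℚ x
      w²≡x = cong ⟨ x ,_⟩ rational-w²
      p²≡x+4 : p * p ≡ fromℚ (x ℚ.+ fromℕ 4)
      p²≡x+4 = trans hp (cong (_+ fromℚ (fromℕ 4)) w²≡x)
      m²≡x-12 : m * m ≡ fromℚ (x ℚ.- fromℕ 12)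
      m²≡x-12 = trans hm (cong (_- fromℚ (fromℕ 12)) w²≡x)
      y = w * p * m

      y²≡cubic : y * y ≡ fromℚ (cubic x (fromℕ 4))
      y²≡cubic = trans (solve 3 (λ w p m → w :* p :* m :* (w :* p :* m) := w :* w :* (p :* p) :* (m :* m)) refl w p m)
        (trans (cong₂ _*_ (cong₂ _*_ w²≡x p²≡x+4) m²≡x-12)
        (trans (cong (_* fromℚ (x ℚ.- fromℕ 12)) (fromℚ-* x (x ℚ.+ fromℕ 4))) (fromℚ-* (x ℚ.* (x ℚ.+ fromℕ 4)) (x ℚ.- fromℕ 12))))

      -- Since y² is rational, one coordinate of y vanishes; with `rat y` nonzero, y would be
      -- rational and (x , y) a rational point on the curve.
      y-rat≡0 : rat y ≡ 0ℚ
      y-rat≡0 = decidable-stable (rat y ℚ.≟ 0ℚ) λ y₀≢0 →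
        let y₁≡0 = x*y≡0⇒y≡0 {fromℕ 2} {irr y} (λ ()) (x*y≡0⇒y≡0 y₀≢0 (trans (F.solve 2 (λ a b → a F.:* (F.con (fromℕ 2) F.:* b) F.:= a F.:* b F.:+ b F.:* a) refl (rat y) (irr y)) (cong irr y²≡cubic)))
        in rational-cubic₁ x (rat y) y₀≢0 (trans (sym (cong rat y²≡cubic)) (trans (cong (λ z → rat y ℚ.* rat y ℚ.+ fromℕ 3 ℚ.* (z ℚ.* z)) y₁≡0) (ℚ.+-identityʳ _)))

      -- What remains is y² = 3 (irr y)², a rational point on the twist.
      y-irr≡0 : irr y ≡ 0ℚ
      y-irr≡0 = decidable-stable (irr y ℚ.≟ 0ℚ) λ y₁≢0 →
        rational-cubic₂ x (irr y) y₁≢0 (trans (sym (cong rat y²≡cubic)) (trans (cong (λ z → z ℚ.* z ℚ.+ fromℕ 3 ℚ.* (irr y ℚ.* irr y)) y-rat≡0) (ℚ.+-identityˡ _)))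

      not-negative : ∀ {q} → 0ℚ ℚ.≤ q → q ℚ.< 0ℚ → ⊥
      not-negative 0≤q q<0 = ℚ.<-irrefl refl (ℚ.≤-<-trans 0≤q q<0)

    -- The product wpm is zero, while w = 0 would make m² = -12 and p = 0 would make w² = -4. For a
    -- triangle m = u - v, so it is isosceles.
    m≡0 : m ≡ fromℚ 0ℚ
    m≡0 = by-factor (x*y≡0 (w * p) m (cong₂ ⟨_,_⟩ y-rat≡0 y-irr≡0))
      where
      w≢0 : w ≢ fromℚ 0ℚ
      w≢0 w≡0 = not-negative (rational-square-nonneg m (trans hm (cong (λ w → w * w - fromℚ (fromℕ 12)) w≡0))) (ℚ.negative⁻¹ _)
      p≢0 : p ≢ fromℚ 0ℚ
      p≢0 p≡0 = not-negative (rational-square-nonneg w (trans (solve 1 (λ w → w :* w := (w :* w :+ con (fromℚ (fromℕ 4))) :- con (fromℚ (fromℕ 4))) refl w)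
        (trans (cong (_- fromℚ (fromℕ 4)) (sym hp)) (cong (λ p → p * p - fromℚ (fromℕ 4)) p≡0)))) (ℚ.negative⁻¹ _)
      by-factor : w * p ≡ fromℚ 0ℚ ⊎ m ≡ fromℚ 0ℚ → m ≡ fromℚ 0ℚ
      by-factor (inj₂ m≡0) = m≡0
      by-factor (inj₁ wp≡0) = ⊥-elim ([ w≢0 , p≢0 ]′ (x*y≡0 w p wp≡0))

  -4ℚ : ℚ
  -4ℚ = ℚ.- fromℕ 4

  norm-* : ∀ x y → norm (x * y) ≡ norm x ℚ.* norm y
  norm-* ⟨ a , b ⟩ ⟨ a′ , b′ ⟩ = F.solve 4 (λ a b a′ b′ →
    (a F.:* a′ F.:+ three F.:* (b F.:* b′)) F.:* (a F.:* a′ F.:+ three F.:* (b F.:* b′)) F.:- three F.:* ((a F.:* b′ F.:+ b F.:* a′) F.:* (a F.:* b′ F.:+ b F.:* a′))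
    F.:= (a F.:* a F.:- three F.:* (b F.:* b)) F.:* (a′ F.:* a′ F.:- three F.:* (b′ F.:* b′))) refl a b a′ b′
    where three = F.con (fromℕ 3)

  p<q⇒0<q-p : ∀ {p q} → p ℚ.< q → 0ℚ ℚ.< q ℚ.- p
  p<q⇒0<q-p {p} {q} p<q = subst (ℚ._< q ℚ.- p) (ℚ.+-inverseʳ p) (ℚ.+-monoˡ-< (ℚ.- p) p<q)

  p<q⇒p-q<0 : ∀ {p q} → p ℚ.< q → p ℚ.- q ℚ.< 0ℚ
  p<q⇒p-q<0 {p} {q} p<q = subst (p ℚ.- q ℚ.<_) (ℚ.+-inverseʳ q) (ℚ.+-monoˡ-< (ℚ.- q) p<q)

  pos*pos : ∀ {p q} → 0ℚ ℚ.< p → 0ℚ ℚ.< q → 0ℚ ℚ.< p ℚ.* q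
  pos*pos {p} {q} 0<p 0<q = ℚ.positive⁻¹ (p ℚ.* q) {{ℚ.pos*pos⇒pos p {{ℚ.positive 0<p}} q {{ℚ.positive 0<q}}}}

  neg*pos : ∀ {p q} → p ℚ.< 0ℚ → 0ℚ ℚ.< q → p ℚ.* q ℚ.< 0ℚ
  neg*pos {p} {q} p<0 0<q = ℚ.negative⁻¹ (p ℚ.* q) {{ℚ.neg*pos⇒neg p {{ℚ.negative p<0}} q {{ℚ.positive 0<q}}}}

  -- v = -4 u⁻¹ = -4 ū / N u, so that rat v and irr v have the wrong sign.
  positive⇒u*v≢-4 : ∀ (u v : ℚ√3) → Positive u → Positive v → u * v ≢ fromℚ -4ℚ
  positive⇒u*v≢-4 u v = go
    where
    module _ (uv≡-4 : u * v ≡ fromℚ -4ℚ) where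
      norms : norm u ℚ.* norm v ≡ fromℕ 16
      norms = trans (sym (norm-* u v)) (cong norm uv≡-4)
      rats : norm u ℚ.* rat v ≡ -4ℚ ℚ.* rat u
      rats = trans (norm*rat u v) (trans (cong (λ z → rat (conj u * z)) uv≡-4)
        (F.solve 2 (λ a b → a F.:* F.con -4ℚ F.:+ F.con (fromℕ 3) F.:* (F.:- b F.:* F.con 0ℚ) F.:= F.con -4ℚ F.:* a) refl (rat u) (irr u)))
      irrs : norm u ℚ.* irr v ≡ fromℕ 4 ℚ.* irr u
      irrs = trans (norm*irr u v) (trans (cong (λ z → irr (conj u * z)) uv≡-4)
        (F.solve 2 (λ a b → a F.:* F.con 0ℚ F.:+ F.:- b F.:* F.con -4ℚ F.:= F.con (fromℕ 4) F.:* b) refl (rat u) (irr u)))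
    0<16 : 0ℚ ℚ.< fromℕ 16
    0<16 = ℚ.positive⁻¹ (fromℕ 16)
    0<4 : 0ℚ ℚ.< fromℕ 4
    0<4 = ℚ.positive⁻¹ (fromℕ 4)
    -4<0 : -4ℚ ℚ.< 0ℚ
    -4<0 = ℚ.negative⁻¹ -4ℚ
    go : Positive u → Positive v → u * v ≢ fromℚ -4ℚ
    go (inj₁ (0<a , n)) (inj₁ (0<a′ , n′)) e = ℚ.<-asym (pos*pos (p<q⇒0<q-p n) 0<a′) (subst (ℚ._< 0ℚ) (sym (rats e)) (neg*pos -4<0 0<a))
    go (inj₁ (0<a , n)) (inj₂ (0<b′ , n′)) e = ℚ.<-asym 0<16 (subst (ℚ._< 0ℚ) (trans (ℚ.*-comm (norm v) (norm u)) (norms e)) (neg*pos (p<q⇒p-q<0 n′) (p<q⇒0<q-p n)))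
    go (inj₂ (0<b , n)) (inj₁ (0<a′ , n′)) e = ℚ.<-asym 0<16 (subst (ℚ._< 0ℚ) (norms e) (neg*pos (p<q⇒p-q<0 n) (p<q⇒0<q-p n′)))
    go (inj₂ (0<b , n)) (inj₂ (0<b′ , n′)) e = ℚ.<-asym (pos*pos 0<4 0<b) (subst (ℚ._< 0ℚ) (irrs e) (neg*pos (p<q⇒p-q<0 n) 0<b′))

  0<x⇒positive : ∀ (x : ℚ√3) → fromℚ 0ℚ < x → Positive x
  0<x⇒positive x = subst Positive (solve 1 (λ x → x :- con (fromℚ 0ℚ) := x) refl x)

  ¬positive-root : ∀ (z : ℚ√3) → (Positive z → ⊥) → ∀ x → fromℚ 0ℚ < x → x ≢ z
  ¬positive-root z ¬z x 0<x refl = ¬z (0<x⇒positive x 0<x)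

  -- Uniqueness of the triangle for n = 1.

  2K : ℚ√3
  2K = fromℚ (fromℕ 2)

  2√3 : ℚ√3
  2√3 = fromℕ 2 √

  -- Sixteen times the squared area is 4(uv)² - (u² + v² - w²)², and at angle 2π/3 the bracket is
  -- -uv.
  heron : ∀ (u v w : ℚ√3) → w * w ≡ u * u + v * v - fromℚ (ℚ.- 1ℚ) * (u * v) →
    16Area² u v w ≡ fromℚ (fromℕ 3) * (u * v * (u * v))
  heron u v w law = trans
    (solve 3 (λ u v w → (u :+ v :+ w) :* (v :+ w :- u) :* (u :+ w :- v) :* (u :+ v :- w)
      := con (fromℚ (fromℕ 4)) :* (u :* v :* (u :* v)) :- (u :* u :+ v :* v :- w :* w) :* (u :* u :+ v :* v :- w :* w)) refl u v w)
    (substituted law)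
    where
    substituted : ∀ {W} → W ≡ u * u + v * v - fromℚ (ℚ.- 1ℚ) * (u * v) →
      fromℚ (fromℕ 4) * (u * v * (u * v)) - (u * u + v * v - W) * (u * u + v * v - W) ≡ fromℚ (fromℕ 3) * (u * v * (u * v))
    substituted refl = solve 2 (λ u v →
      let W = u :* u :+ v :* v :- con (fromℚ (ℚ.- 1ℚ)) :* (u :* v) in
      con (fromℚ (fromℕ 4)) :* (u :* v :* (u :* v)) :- (u :* u :+ v :* v :- W) :* (u :* u :+ v :* v :- W) := con (fromℚ (fromℕ 3)) :* (u :* v :* (u :* v))) refl u v

  module _ {u v w : ℚ√3} (t : IsTriangleFor 3 2π/3 1 u v w) where
    open IsTriangleFor t
    open IsTriangle isTriangle

    uv²≡16 : u * v * (u * v) ≡ fromℚ (fromℕ 4) * fromℚ (fromℕ 4)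
    uv²≡16 = trans (solve 1 (λ z → z := con (fromℚ (+ 1 ℚ./ 3)) :* (con (fromℚ (fromℕ 3)) :* z)) refl (u * v * (u * v)))
      (cong (fromℚ (+ 1 ℚ./ 3) *_) (trans (sym (heron u v w angle)) area))

    -- The area fixes only (uv)² = 16; positivity of u and v under the real embedding excludes -4.
    uv≡4 : u * v ≡ fromℚ (fromℕ 4)
    uv≡4 = [ (λ e → e) , (λ e → ⊥-elim (positive⇒u*v≢-4 u v (0<x⇒positive u 0<u) (0<x⇒positive v 0<v) e)) ]′
      (square-root-cases (u * v) (fromℚ (fromℕ 4)) uv²≡16)

    u+v² : (u + v) * (u + v) ≡ w * w + fromℚ (fromℕ 4)
    u+v² = trans (solve 2 (λ u v → (u :+ v) :* (u :+ v) := (u :* u :+ v :* v :- con (fromℚ (ℚ.- 1ℚ)) :* (u :* v)) :+ u :* v) refl u v)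
      (cong₂ _+_ (sym angle) uv≡4)

    u-v² : (u - v) * (u - v) ≡ w * w - fromℚ (fromℕ 12)
    u-v² = trans (solve 2 (λ u v → (u :- v) :* (u :- v) := (u :* u :+ v :* v :- con (fromℚ (ℚ.- 1ℚ)) :* (u :* v)) :- con (fromℚ (fromℕ 3)) :* (u :* v)) refl u v)
      (cong₂ (λ y z → y - fromℚ (fromℕ 3) * z) (sym angle) uv≡4)

    u≡v : u ≡ v
    u≡v = trans (solve 2 (λ u v → u := (u :- v) :+ v) refl u v)
      (trans (cong (_+ v) (m≡0 w (u + v) (u - v) u+v² u-v²)) (solve 1 (λ v → con (fromℚ 0ℚ) :+ v := v) refl v))

    v≡2 : v ≡ 2K
    v≡2 = [ (λ e → e) , (λ e → ⊥-elim (¬positive-root (fromℚ 0ℚ - 2K) (λ { (inj₁ (*<* () , _)) ; (inj₂ (*<* (+<+ ()) , _)) }) v 0<v e)) ]′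
      (square-root-cases v 2K (trans (cong (_* v) (sym u≡v)) uv≡4))

    w≡2√3 : w ≡ 2√3
    w≡2√3 = [ (λ e → e) , (λ e → ⊥-elim (¬positive-root (fromℚ 0ℚ - 2√3) (λ { (inj₁ (*<* (+<+ ()) , _)) ; (inj₂ (*<* () , _)) }) w 0<w e)) ]′
      (square-root-cases w 2√3 (trans angle (cong₂ (λ u v → u * u + v * v - fromℚ (ℚ.- 1ℚ) * (u * v)) (trans u≡v v≡2) v≡2)))

    unique : (u , v , w) ≡ (2K , 2K , 2√3)
    unique = cong₂ _,_ (trans u≡v v≡2) (cong₂ _,_ v≡2 w≡2√3)

  ¬properlyCongruent : ¬ ProperlyCongruent 3 2π/3 1
  ¬properlyCongruent (f , triangles) = case Injection.injective f (trans (unique (triangles 0)) (sym (unique (triangles 1)))) of λ ()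

-- Infinite families by duplication.

module Families where

  open import Data.Bool.Base using (T)
  open import Data.Empty using (⊥-elim)
  open import Data.Integer.Base using (+_)
  open import Data.Nat.Base as ℕ using (ℕ; zero; suc; NonZero)
  import Data.Nat.Properties as ℕ
  open import Data.Nat.Tactic.RingSolver using (solve-∀)
  open import Data.Product.Base using (_×_; _,_; proj₁; proj₂; ∃)
  open import Data.Rational.Base as ℚ using (ℚ; 0ℚ; 1ℚ; _+_; _*_; _-_; _<_)
  import Data.Rational.Properties as ℚ
  open import Data.Rational.Solver
  open import Data.Sum.Base using (_⊎_; inj₁; inj₂; [_,_]′)
  open import Function.Bundles using (mk↣)
  open import Relation.Binary.Definitions using (Tri; tri<; tri≈; tri>)
  open import Relation.Binary.PropositionalEquality
  open import Relation.Nullary using (yes; no; contradiction)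
  open import Relation.Nullary.Decidable using (isYes; toWitness)
  open import Defs as D using (ℚ[√_]; ⟨_,_⟩; fromℕ; fromℚ; _√; Angle; IsTriangleFor; 16Area²; Congruent; ProperlyCongruent; π/3; π/2; 2π/3)
  open ℚ[√_]
  open +-*-Solver using (solve; con; _:+_; _:*_; _:-_; _:=_)
  open Descent using (Odd; odd; even; parityView; ≤⇒∃+; odd-*; odd+even; odd≢even; odd⇒nonZero)
  open Rationals using (fromℕ-+; fromℕ-*; fromℕ-injective)
  open Quadratic using (pos*pos; p<q⇒0<q-p; fromℚ-*)

  0<q-p⇒p<q : ∀ {p q} → 0ℚ < q - p → p < q
  0<q-p⇒p<q {p} {q} h = subst₂ _<_ (ℚ.+-identityˡ p) (solve 2 (λ p q → q :- p :+ p := q) refl p q) (ℚ.+-monoˡ-< p h)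

  square-cancel-< : ∀ {x y} → 0ℚ < y → 0ℚ < y * y - x * x → x < y
  square-cancel-< {x} {y} 0<y h with x ℚ.<? y
  ... | yes x<y = x<y
  ... | no  x≮y = contradiction (0<q-p⇒p<q h) (λ x²<y² → ℚ.<-irrefl refl (ℚ.<-≤-trans x²<y² y²≤x²))
    where
    y≤x : y ℚ.≤ x
    y≤x = ℚ.≮⇒≥ x≮y
    0<x : 0ℚ < x
    0<x = ℚ.<-≤-trans 0<y y≤x
    y²≤x² : y * y ℚ.≤ x * x
    y²≤x² = ℚ.≤-trans (ℚ.*-monoˡ-≤-nonNeg y {{ℚ.nonNegative (ℚ.<⇒≤ 0<y)}} y≤x) (ℚ.*-monoʳ-≤-nonNeg x {{ℚ.nonNegative (ℚ.<⇒≤ 0<x)}} y≤x)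

  -- Here `e` is 2 cos θ. Once the angle is fixed, prescribing uv = `N` prescribes the area.
  record RationalTriangle (e N : ℚ) (u v w : ℚ) : Set where
    field
      0<u : 0ℚ < u
      0<v : 0ℚ < v
      0<w : 0ℚ < w
      law : w * w ≡ u * u + v * v - e * (u * v)
      uv  : u * v ≡ N

  module Inequalities {e N u v w : ℚ} (t : RationalTriangle e N u v w) (0<2+e : 0ℚ < fromℕ 2 + e) (0<2-e : 0ℚ < fromℕ 2 - e) where
    open RationalTriangle t

    0<uv : 0ℚ < u * v
    0<uv = pos*pos 0<u 0<v

    -- (u + v)² - w² = (2 + e) uv.
    w<u+v : w < u + v
    w<u+v = square-cancel-< (ℚ.+-mono-< 0<u 0<v) (subst (0ℚ <_)
      (trans (solve 3 (λ e u v → (con (fromℕ 2) :+ e) :* (u :* v) := (u :+ v) :* (u :+ v) :- (u :* u :+ v :* v :- e :* (u :* v))) refl e u v)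
             (cong (λ z → (u + v) * (u + v) - z) (sym law))) (pos*pos 0<2+e 0<uv))

    -- w² - (u - v)² = (2 - e) uv. Letting x be any root of (u - v)² serves both u - v and v - u.
    difference<w : ∀ x → x * x ≡ (u - v) * (u - v) → x < w
    difference<w x x² = square-cancel-< 0<w (subst (0ℚ <_)
      (trans (solve 3 (λ e u v → (con (fromℕ 2) :- e) :* (u :* v) := (u :* u :+ v :* v :- e :* (u :* v)) :- (u :- v) :* (u :- v)) refl e u v)
             (cong₂ _-_ (sym law) (sym x²))) (pos*pos 0<2-e 0<uv))

    u<v+w : u < v + w
    u<v+w = subst₂ _<_ (solve 2 (λ u v → v :+ (u :- v) := u) refl u v) refl (ℚ.+-monoʳ-< v (difference<w (u - v) refl))

    v<u+w : v < u + w
    v<u+w = subst₂ _<_ (solve 2 (λ u v → u :+ (v :- u) := v) refl u v) refl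
      (ℚ.+-monoʳ-< u (difference<w (v - u) (solve 2 (λ u v → (v :- u) :* (v :- u) := (u :- v) :* (u :- v)) refl u v)))

  module _ {d : ℕ} where
    fromℚ*√ : ∀ x y → fromℚ {d} x D.* (y √) ≡ (x * y) √
    fromℚ*√ x y = cong₂ ⟨_,_⟩
      (solve 3 (λ δ x y → x :* con 0ℚ :+ δ :* (con 0ℚ :* y) := con 0ℚ) refl (fromℕ d) x y)
      (solve 2 (λ x y → x :* y :+ con 0ℚ :* con 0ℚ := x :* y) refl x y)

    √*√ : ∀ x y → _√ {d} x D.* (y √) ≡ fromℚ (fromℕ d * (x * y))
    √*√ x y = cong₂ ⟨_,_⟩
      (solve 3 (λ δ x y → con 0ℚ :* con 0ℚ :+ δ :* (x :* y) := δ :* (x :* y)) refl (fromℕ d) x y)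
      (solve 2 (λ x y → con 0ℚ :* y :+ x :* con 0ℚ := con 0ℚ) refl x y)

    fromℚ-positive : ∀ {q} → 0ℚ < q → D.Positive (fromℚ {d} q)
    fromℚ-positive {q} 0<q = inj₁ (0<q , subst (_< q * q) (sym (ℚ.*-zeroʳ (fromℕ d))) (pos*pos 0<q 0<q))

    √-positive : .{{_ : NonZero d}} → ∀ {q} → 0ℚ < q → D.Positive (_√ {d} q)
    √-positive 0<q = inj₂ (0<q , pos*pos (ℚ.positive⁻¹ (fromℕ d) {{ℚ.normalize-pos d 1}}) (pos*pos 0<q 0<q))

  -- A ℚ-line in ℚ(√d) through 1 or √d; c is the square of its generator.
  record Line (d : ℕ) : Set where
    field
      E       : ℚ → ℚ[√ d ]
      c       : ℚ
      E-zero  : E 0ℚ ≡ fromℚ 0ℚ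
      E-+     : ∀ x y → E x D.+ E y ≡ E (x + y)
      E--     : ∀ x y → E x D.- E y ≡ E (x - y)
      E-*     : ∀ x y → E x D.* E y ≡ fromℚ (c * (x * y))
      fromℚ-E : ∀ x y → fromℚ x D.* E y ≡ E (x * y)
      E-pos   : ∀ {q} → 0ℚ < q → D.Positive (E q)
      E-inj   : ∀ {x y} → E x ≡ E y → x ≡ y

  rationalLine : ∀ d → Line d
  rationalLine d = record
    { E = fromℚ ; c = 1ℚ ; E-zero = refl ; E-+ = λ _ _ → refl ; E-- = λ _ _ → refl
    ; E-* = λ x y → trans (fromℚ-* {d} x y) (cong fromℚ (sym (ℚ.*-identityˡ (x * y))))
    ; fromℚ-E = fromℚ-* {d} ; E-pos = fromℚ-positive {d} ; E-inj = λ h → cong rat h }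

  irrationalLine : ∀ d .{{_ : NonZero d}} → Line d
  irrationalLine d = record
    { E = _√ ; c = fromℕ d ; E-zero = refl ; E-+ = λ _ _ → refl ; E-- = λ _ _ → refl
    ; E-* = √*√ {d} ; fromℚ-E = fromℚ*√ {d} ; E-pos = √-positive {d} ; E-inj = λ h → cong irr h }

  module _ {d : ℕ} (L : Line d) (θ : Angle) (n : ℕ) where
    open Line L
    e : ℚ
    e = fromℕ 2 * Angle.cosine θ

    E-< : ∀ {x y} → x < y → E x D.< E y
    E-< {x} {y} x<y = subst D.Positive (sym (E-- y x)) (E-pos (p<q⇒0<q-p x<y))

    -- By the law of cosines 16 times the squared area is (4 - e²) N²; scaling the sides by the
    -- generator of the line multiplies it by c².
    toTriangle : ∀ {N u v w} → RationalTriangle e N u v w →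
      0ℚ < fromℕ 2 + e → 0ℚ < fromℕ 2 - e →
      c * c * ((fromℕ 4 - e * e) * (N * N)) ≡ fromℕ 16 * (fromℕ n * fromℕ n * Angle.r²-s² θ) →
      IsTriangleFor d θ n (E u) (E v) (E w)
    toTriangle {N} {u} {v} {w} t 0<2+e 0<2-e area = record
      { isTriangle = record
        { 0<u = pos 0<u ; 0<v = pos 0<v ; 0<w = pos 0<w
        ; u<v+w = subst (E u D.<_) (sym (E-+ v w)) (E-< u<v+w)
        ; v<u+w = subst (E v D.<_) (sym (E-+ u w)) (E-< v<u+w)
        ; w<u+v = subst (E w D.<_) (sym (E-+ u v)) (E-< w<u+v)
        }
      ; angle = begin
          E w D.* E w                                     ≡⟨ E-* w w ⟩
          fromℚ (c * (w * w))                             ≡⟨ cong fromℚ (trans (cong (c *_) law) (solve 4 (λ c e u v →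
              c :* (u :* u :+ v :* v :- e :* (u :* v)) := c :* (u :* u) :+ c :* (v :* v) :- e :* (c :* (u :* v))) refl c e u v)) ⟩
          fromℚ (c * (u * u) + c * (v * v) - e * (c * (u * v)))
            ≡⟨ cong₂ D._-_ (cong₂ D._+_ (E-* u u) (E-* v v)) (trans (cong (fromℚ e D.*_) (E-* u v)) (fromℚ-* e (c * (u * v)))) ⟨
          E u D.* E u D.+ E v D.* E v D.- fromℚ e D.* (E u D.* E v) ∎
      ; area = begin
          16Area² (E u) (E v) (E w)
            ≡⟨ cong₂ D._*_ (cong₂ D._*_ (cong₂ D._*_
                 (trans (cong (D._+ E w) (E-+ u v)) (E-+ (u + v) w))
                 (trans (cong (D._- E u) (E-+ v w)) (E-- (v + w) u)))
                 (trans (cong (D._- E v) (E-+ u w)) (E-- (u + w) v)))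
                 (trans (cong (D._- E w) (E-+ u v)) (E-- (u + v) w)) ⟩
          E (u + v + w) D.* E (v + w - u) D.* E (u + w - v) D.* E (u + v - w)
            ≡⟨ cong (λ z → z D.* E (u + w - v) D.* E (u + v - w)) (E-* (u + v + w) (v + w - u)) ⟩
          fromℚ (c * ((u + v + w) * (v + w - u))) D.* E (u + w - v) D.* E (u + v - w)
            ≡⟨ trans (cong (D._* E (u + v - w)) (fromℚ-E (c * ((u + v + w) * (v + w - u))) (u + w - v))) (E-* (c * ((u + v + w) * (v + w - u)) * (u + w - v)) (u + v - w)) ⟩
          fromℚ (c * (c * ((u + v + w) * (v + w - u)) * (u + w - v) * (u + v - w)))
            ≡⟨ cong fromℚ heron ⟩
          fromℚ (fromℕ 16 * (fromℕ n * fromℕ n * Angle.r²-s² θ)) ∎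
      }
      where
      open ≡-Reasoning
      open RationalTriangle t
      open Inequalities t 0<2+e 0<2-e
      pos : ∀ {x} → 0ℚ < x → fromℚ 0ℚ D.< E x
      pos {x} 0<x = subst (D._< E x) E-zero (E-< 0<x)
      heron : c * (c * ((u + v + w) * (v + w - u)) * (u + w - v) * (u + v - w)) ≡ fromℕ 16 * (fromℕ n * fromℕ n * Angle.r²-s² θ)
      heron = trans (solve 4 (λ c u v w →
            c :* (c :* ((u :+ v :+ w) :* (v :+ w :- u)) :* (u :+ w :- v) :* (u :+ v :- w))
            := c :* c :* (con (fromℕ 4) :* (u :* v :* (u :* v)) :- (u :* u :+ v :* v :- w :* w) :* (u :* u :+ v :* v :- w :* w))) refl c u v w)
        (trans (cong (λ z → c * c * (fromℕ 4 * (u * v * (u * v)) - (u * u + v * v - z) * (u * u + v * v - z))) law)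
        (trans (solve 4 (λ c e u v →
            let z = u :* u :+ v :* v :- e :* (u :* v) in
            c :* c :* (con (fromℕ 4) :* (u :* v :* (u :* v)) :- (u :* u :+ v :* v :- z) :* (u :* u :+ v :* v :- z))
            := c :* c :* ((con (fromℕ 4) :- e :* e) :* (u :* v :* (u :* v)))) refl c e u v)
        (trans (cong (λ z → c * c * ((fromℕ 4 - e * e) * (z * z))) uv) area)))

  -- `D` is |m - 2k|, described by its square so that both signs share one statement; it is applied
  -- to |u² - v²|.
  odd-gap : ∀ m k → Odd m → ∃ λ D → Odd D × fromℕ D * fromℕ D ≡ (fromℕ m - fromℕ (2 ℕ.* k)) * (fromℕ m - fromℕ (2 ℕ.* k))
  odd-gap m k m-odd = [ above , below ]′ (ℕ.≤-total (2 ℕ.* k) m)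
    where
    Gap = ∃ λ D → Odd D × fromℕ D * fromℕ D ≡ (fromℕ m - fromℕ (2 ℕ.* k)) * (fromℕ m - fromℕ (2 ℕ.* k))
    odd-D : ∀ D → m ≡ 2 ℕ.* k ℕ.+ D ⊎ 2 ℕ.* k ≡ m ℕ.+ D → Odd D
    odd-D D h with parityView D
    ... | odd i  = odd i
    ... | even i = ⊥-elim ([ (λ e → odd≢even m-odd (k ℕ.+ i) (trans e (sym (ℕ.*-distribˡ-+ 2 k i))))
                           , (λ e → odd≢even (odd+even m-odd i) k (sym e)) ]′ h)
    above : 2 ℕ.* k ℕ.≤ m → Gap
    above 2k≤m = let D , m≡ = ≤⇒∃+ 2k≤m in D , odd-D D (inj₁ m≡)
      , cong (λ z → z * z) (trans (solve 2 (λ k D → D := k :+ D :- k) refl (fromℕ (2 ℕ.* k)) (fromℕ D))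
          (cong (_- fromℕ (2 ℕ.* k)) (trans (sym (fromℕ-+ (2 ℕ.* k) D)) (cong fromℕ (sym m≡)))))
    below : m ℕ.≤ 2 ℕ.* k → Gap
    below m≤2k = let D , 2k≡ = ≤⇒∃+ m≤2k in D , odd-D D (inj₂ 2k≡)
      , trans (solve 2 (λ m D → D :* D := (m :- (m :+ D)) :* (m :- (m :+ D))) refl (fromℕ m) (fromℕ D))
          (cong (λ z → (fromℕ m - z) * (fromℕ m - z)) (trans (sym (fromℕ-+ m D)) (cong fromℕ (sym 2k≡))))

  -- The triangle (u / z , v / z , w / z), where e = 2 cos θ and N = uv / z².
  record Seed (e N : ℚ) : Set where
    field
      u h w z : ℕ
      {{h≢0}} : NonZero h
      {{z≢0}} : NonZero z
      u-odd   : Odd u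
      w-odd   : Odd w
    v = 2 ℕ.* h
    field
      law  : fromℕ w * fromℕ w ≡ fromℕ u * fromℕ u + fromℕ v * fromℕ v - e * (fromℕ u * fromℕ v)
      area : fromℕ u * fromℕ v ≡ N * (fromℕ z * fromℕ z)

    instance
      u≢0 : NonZero u
      u≢0 = odd⇒nonZero u-odd
      w≢0 : NonZero w
      w≢0 = odd⇒nonZero w-odd
      v≢0 : NonZero v
      v≢0 = ℕ.m*n≢0 2 h
      ιz-positive : ℚ.Positive (fromℕ z)
      ιz-positive = ℚ.normalize-pos z 1
      ιz≢0 : ℚ.NonZero (fromℕ z)
      ιz≢0 = ℚ.pos⇒nonZero (fromℕ z)

    ζ : ℚ
    ζ = ℚ.1/ fromℕ z

    z*ζ≡1 : fromℕ z * ζ ≡ 1ℚ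
    z*ζ≡1 = ℚ.*-inverseʳ (fromℕ z)

    private
      quotient-positive : ∀ n .{{_ : NonZero n}} → 0ℚ < fromℕ n * ζ
      quotient-positive n = pos*pos (ℚ.positive⁻¹ (fromℕ n) {{ℚ.normalize-pos n 1}}) (ℚ.positive⁻¹ ζ {{ℚ.1/pos⇒pos (fromℕ z)}})

    rationalTriangle : RationalTriangle e N (fromℕ u * ζ) (fromℕ v * ζ) (fromℕ w * ζ)
    rationalTriangle = record
      { 0<u = quotient-positive u ; 0<v = quotient-positive v ; 0<w = quotient-positive w
      ; law = trans (solve 2 (λ w ζ → w :* ζ :* (w :* ζ) := w :* w :* (ζ :* ζ)) refl (fromℕ w) ζ)
          (trans (cong (_* (ζ * ζ)) law)
          (solve 4 (λ e u v ζ → (u :* u :+ v :* v :- e :* (u :* v)) :* (ζ :* ζ)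
             := u :* ζ :* (u :* ζ) :+ v :* ζ :* (v :* ζ) :- e :* (u :* ζ :* (v :* ζ))) refl e (fromℕ u) (fromℕ v) ζ))
      ; uv = trans (solve 3 (λ u v ζ → u :* ζ :* (v :* ζ) := u :* v :* (ζ :* ζ)) refl (fromℕ u) (fromℕ v) ζ)
          (trans (cong (_* (ζ * ζ)) area)
          (trans (solve 3 (λ N z ζ → N :* (z :* z) :* (ζ :* ζ) := N :* (z :* ζ :* (z :* ζ))) refl N (fromℕ z) ζ)
          (trans (cong (λ y → N * (y * y)) z*ζ≡1) (ℚ.*-identityʳ N))))
      }

  -- Doubling the point with x = (w / 2z)² gives the triangle with sides
  -- (u² - v²) / 2wz, 2uvw / (u² - v²)z and (w⁴ + (4 - e²)u²v²) / 2wz(u² - v²).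
  module _ {e N : ℚ} (κ : ℕ) (κ≡ : fromℕ κ ≡ fromℕ 4 - e * e) where

    double : Seed e N → Seed e N
    double S = record
      -- Over the common denominator 2wDz, where D = |u² - v²|, the sides have numerators D², 4uvw²
      -- and w⁴ + (4 - e²)u²v². Here 2k is the last summand, even because v is, so the third
      -- numerator stays odd.
      { u = D ℕ.* D ; h = 2 ℕ.* (u ℕ.* v ℕ.* (w ℕ.* w)) ; w = w ℕ.* w ℕ.* (w ℕ.* w) ℕ.+ 2 ℕ.* k ; z = 2 ℕ.* (w ℕ.* D ℕ.* z)
      ; h≢0 = ℕ.m*n≢0 2 _ {{_}} {{ℕ.m*n≢0 (u ℕ.* v) (w ℕ.* w) {{ℕ.m*n≢0 u v}} {{ℕ.m*n≢0 w w}}}}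
      ; z≢0 = ℕ.m*n≢0 2 _ {{_}} {{ℕ.m*n≢0 (w ℕ.* D) z {{ℕ.m*n≢0 w D {{w≢0}} {{odd⇒nonZero D-odd}}}}}}
      ; u-odd = odd-* D-odd D-odd
      ; w-odd = odd+even (odd-* (odd-* w-odd w-odd) (odd-* w-odd w-odd)) k
      ; law = law′
      ; area = area′
      }
      where
      open Seed S
      ιu = fromℕ u
      ιv = fromℕ v
      ιw = fromℕ w
      gap = odd-gap (u ℕ.* u) (2 ℕ.* (h ℕ.* h)) (odd-* u-odd u-odd)
      D = proj₁ gap
      D-odd : Odd D
      D-odd = proj₁ (proj₂ gap)
      k = κ ℕ.* (u ℕ.* h ℕ.* (u ℕ.* v))
      v²≡ : fromℕ (2 ℕ.* (2 ℕ.* (h ℕ.* h))) ≡ ιv * ιv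
      v²≡ = trans (cong fromℕ (eq h)) (fromℕ-* v v)
        where
        eq : ∀ h → 2 ℕ.* (2 ℕ.* (h ℕ.* h)) ≡ 2 ℕ.* h ℕ.* (2 ℕ.* h)
        eq = solve-∀
      D² : fromℕ D * fromℕ D ≡ (ιu * ιu - ιv * ιv) * (ιu * ιu - ιv * ιv)
      D² = trans (proj₂ (proj₂ gap)) (cong₂ (λ x y → (x - y) * (x - y)) (fromℕ-* u u) v²≡)
      u′≡ : fromℕ (D ℕ.* D) ≡ (ιu * ιu - ιv * ιv) * (ιu * ιu - ιv * ιv)
      u′≡ = trans (fromℕ-* D D) D²
      v′≡ : fromℕ (2 ℕ.* (2 ℕ.* (u ℕ.* v ℕ.* (w ℕ.* w)))) ≡ fromℕ 4 * (ιu * ιv * (ιw * ιw))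
      v′≡ = trans (cong fromℕ (sym (ℕ.*-assoc 2 2 (u ℕ.* v ℕ.* (w ℕ.* w)))))
        (trans (fromℕ-* 4 (u ℕ.* v ℕ.* (w ℕ.* w))) (cong (fromℕ 4 *_) (trans (fromℕ-* (u ℕ.* v) (w ℕ.* w)) (cong₂ _*_ (fromℕ-* u v) (fromℕ-* w w)))))
      w′≡ : fromℕ (w ℕ.* w ℕ.* (w ℕ.* w) ℕ.+ 2 ℕ.* k) ≡ ιw * ιw * (ιw * ιw) + (fromℕ 4 - e * e) * (ιu * ιv * (ιu * ιv))
      w′≡ = trans (fromℕ-+ (w ℕ.* w ℕ.* (w ℕ.* w)) (2 ℕ.* k)) (cong₂ _+_
        (trans (fromℕ-* (w ℕ.* w) (w ℕ.* w)) (cong (λ x → x * x) (fromℕ-* w w)))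
        (trans (cong fromℕ (eq κ u h)) (trans (fromℕ-* κ _) (cong₂ _*_ κ≡ (trans (fromℕ-* (u ℕ.* v) (u ℕ.* v)) (cong (λ x → x * x) (fromℕ-* u v)))))))
        where
        eq : ∀ κ u h → 2 ℕ.* (κ ℕ.* (u ℕ.* h ℕ.* (u ℕ.* (2 ℕ.* h)))) ≡ κ ℕ.* (u ℕ.* (2 ℕ.* h) ℕ.* (u ℕ.* (2 ℕ.* h)))
        eq = solve-∀
      z′≡ : fromℕ (2 ℕ.* (w ℕ.* D ℕ.* z)) ≡ fromℕ 2 * (ιw * fromℕ D * fromℕ z)
      z′≡ = trans (fromℕ-* 2 (w ℕ.* D ℕ.* z)) (cong (fromℕ 2 *_) (trans (fromℕ-* (w ℕ.* D) z) (cong (_* fromℕ z) (fromℕ-* w D))))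
      -- Only w² enters, so `q` replaces it and the old law of cosines eliminates it, leaving an
      -- identity in the other two sides.
      polynomial : ∀ x y q → q ≡ x * x + y * y - e * (x * y) →
        (q * q + (fromℕ 4 - e * e) * (x * y * (x * y))) * (q * q + (fromℕ 4 - e * e) * (x * y * (x * y)))
        ≡ (x * x - y * y) * (x * x - y * y) * ((x * x - y * y) * (x * x - y * y)) + fromℕ 4 * (x * y * q) * (fromℕ 4 * (x * y * q))
          - e * ((x * x - y * y) * (x * x - y * y) * (fromℕ 4 * (x * y * q)))
      polynomial x y q refl = solve 3 (λ e x y →
        let q = x :* x :+ y :* y :- e :* (x :* y)
            d = (x :* x :- y :* y) :* (x :* x :- y :* y)
            v = con (fromℕ 4) :* (x :* y :* q)
            w = q :* q :+ (con (fromℕ 4) :- e :* e) :* (x :* y :* (x :* y))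
        in w :* w := d :* d :+ v :* v :- e :* (d :* v)) refl e x y
      law′ = trans (cong (λ x → x * x) w′≡) (trans (polynomial ιu ιv (ιw * ιw) law)
        (sym (cong₂ (λ x y → x * x + y * y - e * (x * y)) u′≡ v′≡)))
      area′ = trans (cong₂ _*_ (fromℕ-* D D) v′≡)
        (trans (solve 4 (λ D u v w → D :* D :* (con (fromℕ 4) :* (u :* v :* (w :* w))) := u :* v :* (con (fromℕ 4) :* (w :* w :* (D :* D)))) refl (fromℕ D) ιu ιv ιw)
        (trans (cong (_* (fromℕ 4 * (ιw * ιw * (fromℕ D * fromℕ D)))) area)
        (trans (solve 4 (λ N z w D → N :* (z :* z) :* (con (fromℕ 4) :* (w :* w :* (D :* D))) := N :* (con (fromℕ 2) :* (w :* D :* z) :* (con (fromℕ 2) :* (w :* D :* z)))) refl N (fromℕ z) ιw (fromℕ D))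
        (cong (λ x → N * (x * x)) (sym z′≡)))))

    double-z : ∀ S → ∃ λ m → Seed.z (double S) ≡ 2 ℕ.* (m ℕ.* Seed.z S)
    double-z S = Seed.w S ℕ.* proj₁ (odd-gap (Seed.u S ℕ.* Seed.u S) (2 ℕ.* (Seed.h S ℕ.* Seed.h S)) (odd-* (Seed.u-odd S) (Seed.u-odd S))) , refl

    module _ (S₀ : Seed e N) where
      seed : ℕ → Seed e N
      seed zero    = S₀
      seed (suc i) = double (seed i)

      2zᵢ∣zⱼ : ∀ i k → ∃ λ m → Seed.z (seed (suc (k ℕ.+ i))) ≡ 2 ℕ.* (m ℕ.* Seed.z (seed i))
      2zᵢ∣zⱼ i zero    = double-z (seed i)
      2zᵢ∣zⱼ i (suc k) = let m , z≡ = 2zᵢ∣zⱼ i k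
                             l , z′≡ = double-z (seed (suc (k ℕ.+ i)))
                         in l ℕ.* (2 ℕ.* m) , trans z′≡ (trans (cong (λ z → 2 ℕ.* (l ℕ.* z)) z≡) (cong (2 ℕ.*_) (eq l m (Seed.z (seed i)))))
        where
        eq : ∀ l m z → l ℕ.* (2 ℕ.* (m ℕ.* z)) ≡ l ℕ.* (2 ℕ.* m) ℕ.* z
        eq = solve-∀

      -- Cross-multiplying with z B = 2 m z A gives w B = 2 m w A, although w B is odd.
      ratio≢ : ∀ i k → fromℕ (Seed.w (seed i)) * Seed.ζ (seed i) ≢ fromℕ (Seed.w (seed (suc (k ℕ.+ i)))) * Seed.ζ (seed (suc (k ℕ.+ i)))
      ratio≢ i k e = odd≢even (w-odd B) (m ℕ.* w A) (ℕ.*-cancelʳ-≡ (w B) (2 ℕ.* (m ℕ.* w A)) (z A) {{z≢0 A}} (fromℕ-injective (sym (begin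
        fromℕ (2 ℕ.* (m ℕ.* w A) ℕ.* z A)             ≡⟨ cong fromℕ (eq m (w A) (z A)) ⟩
        fromℕ (w A ℕ.* (2 ℕ.* (m ℕ.* z A)))           ≡⟨ cong (λ y → fromℕ (w A ℕ.* y)) zB≡ ⟨
        fromℕ (w A ℕ.* z B)                           ≡⟨ fromℕ-* (w A) (z B) ⟩
        fromℕ (w A) * fromℕ (z B)                     ≡⟨ cross (fromℕ (w A)) (fromℕ (z B)) (fromℕ (z A)) (ζ A) (z*ζ≡1 A) ⟨
        fromℕ (w A) * ζ A * (fromℕ (z A) * fromℕ (z B)) ≡⟨ cong (_* (fromℕ (z A) * fromℕ (z B))) e ⟩
        fromℕ (w B) * ζ B * (fromℕ (z A) * fromℕ (z B)) ≡⟨ cong (fromℕ (w B) * ζ B *_) (ℚ.*-comm (fromℕ (z A)) (fromℕ (z B))) ⟩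
        fromℕ (w B) * ζ B * (fromℕ (z B) * fromℕ (z A)) ≡⟨ cross (fromℕ (w B)) (fromℕ (z A)) (fromℕ (z B)) (ζ B) (z*ζ≡1 B) ⟩
        fromℕ (w B) * fromℕ (z A)                     ≡⟨ fromℕ-* (w B) (z A) ⟨
        fromℕ (w B ℕ.* z A)                           ∎))))
        where
        open ≡-Reasoning
        open Seed
        A = seed i
        B = seed (suc (k ℕ.+ i))
        m = proj₁ (2zᵢ∣zⱼ i k)
        zB≡ = proj₂ (2zᵢ∣zⱼ i k)
        eq : ∀ m w z → 2 ℕ.* (m ℕ.* w) ℕ.* z ≡ w ℕ.* (2 ℕ.* (m ℕ.* z))
        eq = solve-∀
        cross : ∀ w y z ζ → z * ζ ≡ 1ℚ → w * ζ * (z * y) ≡ w * y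
        cross w y z ζ zζ≡1 = trans (solve 4 (λ w y z ζ → w :* ζ :* (z :* y) := z :* ζ :* (w :* y)) refl w y z ζ) (trans (cong (_* (w * y)) zζ≡1) (ℚ.*-identityˡ (w * y)))

      ratio : ℕ → ℚ
      ratio i = fromℕ (Seed.w (seed i)) * Seed.ζ (seed i)

      ratio-< : ∀ {i j} → i ℕ.< j → ratio i ≢ ratio j
      ratio-< {i} i<j = go (≤⇒∃+ i<j)
        where
        go : ∀ {j} → (∃ λ k → j ≡ suc i ℕ.+ k) → ratio i ≢ ratio j
        go (k , refl) = subst (λ n → ratio i ≢ ratio (suc n)) (ℕ.+-comm k i) (ratio≢ i k)

      ratio-injective : ∀ {i j} → ratio i ≡ ratio j → i ≡ j
      ratio-injective {i} {j} e = go (ℕ.<-cmp i j)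
        where
        go : Tri (i ℕ.< j) (i ≡ j) (j ℕ.< i) → i ≡ j
        go (tri< i<j _ _) = contradiction e (ratio-< i<j)
        go (tri≈ _ i≡j _) = i≡j
        go (tri> _ _ j<i) = contradiction (sym e) (ratio-< j<i)

  module _ {d : ℕ} (L : Line d) (θ : Angle) (n : ℕ) {N : ℚ} (S : Seed (e L θ n) N)
    (0<2+e : 0ℚ < fromℕ 2 + e L θ n) (0<2-e : 0ℚ < fromℕ 2 - e L θ n)
    (area : Line.c L * Line.c L * ((fromℕ 4 - e L θ n * e L θ n) * (N * N)) ≡ fromℕ 16 * (fromℕ n * fromℕ n * Angle.r²-s² θ)) where
    open Line L

    side : ∀ (S : Seed (e L θ n) N) → ℕ → ℚ[√ d ]
    side S m = E (fromℕ m * Seed.ζ S)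

    triangle : ∀ S → IsTriangleFor d θ n (side S (Seed.u S)) (side S (Seed.v S)) (side S (Seed.w S))
    triangle S = toTriangle L θ n (Seed.rationalTriangle S) 0<2+e 0<2-e area

    properlyCongruent : ∀ κ → fromℕ κ ≡ fromℕ 4 - e L θ n * e L θ n → ProperlyCongruent d θ n
    properlyCongruent κ κ≡ = mk↣ {to = sides} injective , λ i → triangle (seeds i)
      where
      seeds = seed κ κ≡ S
      sides : ℕ → ℚ[√ d ] × ℚ[√ d ] × ℚ[√ d ]
      sides i = let T = seeds i in side T (Seed.u T) , side T (Seed.v T) , side T (Seed.w T)
      injective : ∀ {i j} → sides i ≡ sides j → i ≡ j
      -- The third sides alone separate the triangles.
      injective h = ratio-injective κ κ≡ S (E-inj (cong (λ t → proj₂ (proj₂ t)) h))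

  -- The given triangles.

  congruent : Congruent 3 2π/3 1
  congruent = fromℚ (fromℕ 2) , fromℚ (fromℕ 2) , fromℕ 2 √ , record
    { isTriangle = record
      { 0<u = inj₁ (lt , lt) ; 0<v = inj₁ (lt , lt) ; 0<w = inj₂ (lt , lt)
      ; u<v+w = inj₂ (lt , lt) ; v<u+w = inj₂ (lt , lt) ; w<u+v = inj₁ (lt , lt) }
    ; angle = refl ; area = refl }
    where
    lt : ∀ {p q} {_ : T (isYes (p ℚ.<? q))} → p < q
    lt {p} {q} {t} = toWitness {a? = p ℚ.<? q} t

  -- (13, 48, 43) / 26, the given sides without √13; `h` is half of 48.
  seed₁₃ : Seed (fromℕ 2 * Angle.cosine π/3) (+ 12 ℚ./ 13)
  seed₁₃ = record { u = 13 ; h = 24 ; w = 43 ; z = 26 ; u-odd = odd 6 ; w-odd = odd 21 ; law = refl ; area = refl }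

  -- (9, 56, 61) / 21, the given sides without √7.
  seed₇ : Seed (fromℕ 2 * Angle.cosine 2π/3) (+ 8 ℚ./ 7)
  seed₇ = record { u = 9 ; h = 28 ; w = 61 ; z = 21 ; u-odd = odd 4 ; w-odd = odd 30 ; law = refl ; area = refl }

  -- The triangle (3, 8, 7) has angle π/3 and area 6√3, so `rationalLine` suffices.
  seed₅ : Seed (fromℕ 2 * Angle.cosine π/3) (fromℕ 24)
  seed₅ = record { u = 3 ; h = 4 ; w = 7 ; z = 1 ; u-odd = odd 1 ; w-odd = odd 3 ; law = refl ; area = refl }

  -- (5, 12, 13) / 5, a right triangle; multiplied by √5 it has area 6.
  seed₅′ : Seed (fromℕ 2 * Angle.cosine π/2) (+ 12 ℚ./ 5)
  seed₅′ = record { u = 5 ; h = 6 ; w = 13 ; z = 5 ; u-odd = odd 2 ; w-odd = odd 6 ; law = refl ; area = refl }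

  pos : ∀ {q} {{_ : ℚ.Positive q}} → 0ℚ < q
  pos {q} = ℚ.positive⁻¹ q

  properlyCongruent₁₃ : ProperlyCongruent 13 π/3 3
  -- The last 3 is κ = 4 - e², with e = 1; it is 3 for cosine ±1/2 and 4 for the right angle.
  properlyCongruent₁₃ = properlyCongruent (irrationalLine 13) π/3 3 seed₁₃ pos pos refl 3 refl

  triangle₁₃ : IsTriangleFor 13 π/3 3 ((+ 1 ℚ./ 2) √) ((+ 24 ℚ./ 13) √) ((+ 43 ℚ./ 26) √)
  triangle₁₃ = triangle (irrationalLine 13) π/3 3 seed₁₃ pos pos refl seed₁₃

  properlyCongruent₇ : ProperlyCongruent 7 2π/3 2
  properlyCongruent₇ = properlyCongruent (irrationalLine 7) 2π/3 2 seed₇ pos pos refl 3 refl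

  triangle₇ : IsTriangleFor 7 2π/3 2 ((+ 3 ℚ./ 7) √) ((+ 8 ℚ./ 3) √) ((+ 61 ℚ./ 21) √)
  triangle₇ = triangle (irrationalLine 7) 2π/3 2 seed₇ pos pos refl seed₇

  properlyCongruent₅ : ProperlyCongruent 5 π/3 6
  properlyCongruent₅ = properlyCongruent (rationalLine 5) π/3 6 seed₅ pos pos refl 3 refl

  properlyCongruent₅′ : ProperlyCongruent 5 π/2 6
  properlyCongruent₅′ = properlyCongruent (irrationalLine 5) π/2 6 seed₅′ pos pos refl 4 refl

  triangle₅′ : IsTriangleFor 5 π/2 6 ((+ 1 ℚ./ 1) √) ((+ 12 ℚ./ 5) √) ((+ 13 ℚ./ 5) √)
  triangle₅′ = triangle (irrationalLine 5) π/2 6 seed₅′ pos pos refl seed₅′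

open import Defs
open import Data.Integer.Base using (+_)
open import Data.Rational.Base using (_/_)
open import Data.Product.Base using (_×_; _,_)
open import Relation.Nullary.Negation.Core using (¬_)
open Quadratic using (¬properlyCongruent)
open Families

theorem2p6 : (Congruent 3 2π/3 1 × ¬ ProperlyCongruent 3 2π/3 1)
    × (ProperlyCongruent 13 π/3 3
    × IsTriangleFor 13 π/3 3 ((+ 1 / 2) √) ((+ 24 / 13) √) ((+ 43 / 26) √))
    × (ProperlyCongruent 7 2π/3 2
    × IsTriangleFor 7 2π/3 2 ((+ 3 / 7) √) ((+ 8 / 3) √) ((+ 61 / 21) √))
    × (ProperlyCongruent 5 π/3 6
    × ProperlyCongruent 5 π/2 6
    × IsTriangleFor 5 π/2 6 ((+ 1 / 1) √) ((+ 12 / 5) √) ((+ 13 / 5) √))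
theorem2p6 =
    (congruent , ¬properlyCongruent)
  , (properlyCongruent₁₃ , triangle₁₃)
  , (properlyCongruent₇ , triangle₇)
  , (properlyCongruent₅ , properlyCongruent₅′ , triangle₅′)
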